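{- Let $n_1\geqslant n_2\geqslant\cdots\geqslant n_p$ be positive integers with $\sum_{i=1}^p n_i=n$, and let $G=K_{n_1}\cup K_{n_2}\cup\cdots\cup K_{n_p}$ be the graph on $n$ vertices consisting of $p$ complete components $K_{n_1},\dots,K_{n_p}$, so that it has $m=\sum_{i=1}^p\binom{n_i}{2}$ edges. Assume $$n_1-\frac{n_1^2+n_2^2+\cdots+n_p^2}{n}<1.$$ Then $G$ is a Largest Eigenvalue Global Minimizer (LEGM).
   Context: All graphs are simple, undirected and unweighted (no self loops, no multiple edges). The Laplacian of $G$ is $L(G)=D(G)-A(G)$, where $D(G)$ is the diagonal matrix of vertex degrees and $A(G)$ is the adjacency matrix; $\lambda_1(G)$ denotes the largest eigenvalue of $L(G)$. $K_r$ is the complete graph on $r$ vertices and $\cup$ denotes disjoint union of graphs. A graph $G$ with $n$ vertices and $m$ edges is a Largest Eigenvalue Global Minimizer (LEGM) if $\lambda_1(G)\leqslant\lambda_1(H)$ for every simple graph $H$ with $n$ vertices and $m$ edges. -}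

module Defs where

open import Data.Bool using (Bool; false; not; _∧_; if_then_else_)
open import Data.Fin using (Fin; splitAt; _<?_) renaming (_≟_ to _≟ᶠ_)
open import Data.Fin.Subset using (Subset; ∣_∣)
open import Data.Integer using (ℤ; +_; 0ℤ; 1ℤ) renaming (_-_ to _-ℤ_)
open import Data.List using (List; []; _∷_; length; filterᵇ; cartesianProduct; allFin)
open import Data.List.Relation.Unary.All using (All; _∷_)
open import Data.Nat using (ℕ; zero; suc; _⊔_; NonZero)
  renaming (_+_ to _+ℕ_; _≤_ to _≤ℕ_)
open import Data.Nat.ListAction using (sum)
import Data.Nat.Properties as ℕ
open import Data.Product using (∃; _×_; _,_)
open import Data.Rational as ℚ using (ℚ; 0ℚ; 1ℚ; ½)
import Data.Rational.Properties as ℚ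
import Data.Rational.Solver as ℚSolver
open import Data.Sum using (_⊎_; inj₁; inj₂)
open import Data.Vec using (tabulate)
open import Data.Vec.Functional using (Vector; foldr)
open import Relation.Binary.PropositionalEquality
  using (_≡_; refl; sym; trans; cong; cong₂; subst)
open import Relation.Nullary using (¬_; yes; no; contradiction)
open import Relation.Nullary.Decidable using (⌊_⌋)

-- The reals are Cauchy sequences of rationals; there are no quotients, so
-- equality of reals is the relation _≈_ and never _≡_.

Cauchy : (ℕ → ℚ) → Set
Cauchy x = ∀ ε → 0ℚ ℚ.< ε →
  ∃ λ N → ∀ m n → N ≤ℕ m → N ≤ℕ n → ℚ.∣ x m ℚ.- x n ∣ ℚ.< ε

record ℝ : Set where
  constructor real
  field
    seq    : ℕ → ℚ
    cauchy : Cauchy seq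

open ℝ public

infix 4 _≈_ _≤_

_≈_ : ℝ → ℝ → Set
x ≈ y = ∀ ε → 0ℚ ℚ.< ε →
  ∃ λ N → ∀ n → N ≤ℕ n → ℚ.∣ seq x n ℚ.- seq y n ∣ ℚ.< ε

_≤_ : ℝ → ℝ → Set
x ≤ y = ∀ ε → 0ℚ ℚ.< ε →
  ∃ λ N → ∀ n → N ≤ℕ n → seq x n ℚ.< seq y n ℚ.+ ε

private module S = ℚSolver.+-*-Solver

half-pos : ∀ {ε} → 0ℚ ℚ.< ε → 0ℚ ℚ.< ½ ℚ.* ε
half-pos {ε} 0<ε = subst (ℚ._< ½ ℚ.* ε) (ℚ.*-zeroʳ ½) (ℚ.*-monoʳ-<-pos ½ 0<ε)

halves : ∀ ε → ½ ℚ.* ε ℚ.+ ½ ℚ.* ε ≡ ε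
halves ε = trans (sym (ℚ.*-distribʳ-+ ε ½ ½)) (ℚ.*-identityˡ ε)

+-cauchy : ∀ x y → Cauchy x → Cauchy y → Cauchy (λ n → x n ℚ.+ y n)
+-cauchy x y cx cy ε 0<ε
  with cx (½ ℚ.* ε) (half-pos 0<ε) | cy (½ ℚ.* ε) (half-pos 0<ε)
... | M , p | N , q = M ⊔ N , λ m n m≥ n≥ → begin-strict
  ℚ.∣ (x m ℚ.+ y m) ℚ.- (x n ℚ.+ y n) ∣
    ≡⟨ cong ℚ.∣_∣ (S.solve 4 (λ a b c d →
         (a S.:+ b) S.:- (c S.:+ d) S.:= (a S.:- c) S.:+ (b S.:- d))
         refl (x m) (y m) (x n) (y n)) ⟩
  ℚ.∣ (x m ℚ.- x n) ℚ.+ (y m ℚ.- y n) ∣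
    ≤⟨ ℚ.∣p+q∣≤∣p∣+∣q∣ (x m ℚ.- x n) (y m ℚ.- y n) ⟩
  ℚ.∣ x m ℚ.- x n ∣ ℚ.+ ℚ.∣ y m ℚ.- y n ∣
    <⟨ ℚ.+-mono-< (p m n (ℕ.m⊔n≤o⇒m≤o M N m≥) (ℕ.m⊔n≤o⇒m≤o M N n≥))
                  (q m n (ℕ.m⊔n≤o⇒n≤o M N m≥) (ℕ.m⊔n≤o⇒n≤o M N n≥)) ⟩
  ½ ℚ.* ε ℚ.+ ½ ℚ.* ε
    ≡⟨ halves ε ⟩
  ε ∎
  where open ℚ.≤-Reasoning

maxUpTo : (ℕ → ℚ) → ℕ → ℚ
maxUpTo x zero    = ℚ.∣ x zero ∣
maxUpTo x (suc N) = maxUpTo x N ℚ.⊔ ℚ.∣ x (suc N) ∣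

≤-maxUpTo : ∀ x N n → n ≤ℕ N → ℚ.∣ x n ∣ ℚ.≤ maxUpTo x N
≤-maxUpTo x zero    zero _ = ℚ.≤-refl
≤-maxUpTo x (suc N) n n≤ with ℕ.m≤n⇒m<n∨m≡n n≤
... | inj₁ n<   = ℚ.≤-trans (≤-maxUpTo x N n (ℕ.≤-pred n<)) (ℚ.p≤p⊔q _ _)
... | inj₂ refl = ℚ.p≤q⊔p (maxUpTo x N) _

bounded : ∀ x → Cauchy x → ∃ λ B → 0ℚ ℚ.< B × (∀ n → ℚ.∣ x n ∣ ℚ.≤ B)
bounded x cx with cx 1ℚ (ℚ.positive⁻¹ 1ℚ)
... | N , p = 1ℚ ℚ.+ M , 0<B , bound
  where
  open ℚ.≤-Reasoning
  M = maxUpTo x N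

  0≤M : 0ℚ ℚ.≤ M
  0≤M = ℚ.≤-trans (ℚ.0≤∣p∣ (x N)) (≤-maxUpTo x N N ℕ.≤-refl)

  0<B : 0ℚ ℚ.< 1ℚ ℚ.+ M
  0<B = ℚ.+-mono-<-≤ (ℚ.positive⁻¹ 1ℚ) 0≤M

  bound : ∀ n → ℚ.∣ x n ∣ ℚ.≤ 1ℚ ℚ.+ M
  bound n with ℕ.≤-total n N
  ... | inj₁ n≤N = begin
    ℚ.∣ x n ∣  ≤⟨ ≤-maxUpTo x N n n≤N ⟩
    M          ≡⟨ ℚ.+-identityˡ M ⟨
    0ℚ ℚ.+ M   ≤⟨ ℚ.+-monoˡ-≤ M (ℚ.<⇒≤ (ℚ.positive⁻¹ 1ℚ)) ⟩
    1ℚ ℚ.+ M   ∎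
  ... | inj₂ N≤n = begin
    ℚ.∣ x n ∣
      ≡⟨ cong ℚ.∣_∣ (S.solve 2 (λ a b → a S.:= (a S.:- b) S.:+ b) refl (x n) (x N)) ⟩
    ℚ.∣ (x n ℚ.- x N) ℚ.+ x N ∣
      ≤⟨ ℚ.∣p+q∣≤∣p∣+∣q∣ (x n ℚ.- x N) (x N) ⟩
    ℚ.∣ x n ℚ.- x N ∣ ℚ.+ ℚ.∣ x N ∣
      ≤⟨ ℚ.+-mono-≤ (ℚ.<⇒≤ (p n N N≤n ℕ.≤-refl)) (≤-maxUpTo x N N ℕ.≤-refl) ⟩
    1ℚ ℚ.+ M ∎

scale : ∀ {B ε} → 0ℚ ℚ.< B → 0ℚ ℚ.< ε →
        ∃ λ δ → 0ℚ ℚ.< δ × B ℚ.* δ ≡ ε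
scale {B} {ε} 0<B 0<ε = 1/B ℚ.* ε , 0<δ , eq
  where
  instance
    B>0 : ℚ.Positive B
    B>0 = ℚ.positive 0<B
    B≢0 : ℚ.NonZero B
    B≢0 = ℚ.pos⇒nonZero B
  1/B = ℚ.1/ B
  instance
    1/B>0 : ℚ.Positive 1/B
    1/B>0 = ℚ.1/pos⇒pos B
  0<δ : 0ℚ ℚ.< 1/B ℚ.* ε
  0<δ = subst (ℚ._< 1/B ℚ.* ε) (ℚ.*-zeroʳ 1/B) (ℚ.*-monoʳ-<-pos 1/B 0<ε)
  eq : B ℚ.* (1/B ℚ.* ε) ≡ ε
  eq = trans (sym (ℚ.*-assoc B 1/B ε))
             (trans (cong (ℚ._* ε) (ℚ.*-inverseʳ B)) (ℚ.*-identityˡ ε))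

∣*∣-< : ∀ {B δ} a b → 0ℚ ℚ.< B → ℚ.∣ a ∣ ℚ.≤ B → ℚ.∣ b ∣ ℚ.< δ →
        ℚ.∣ a ℚ.* b ∣ ℚ.< B ℚ.* δ
∣*∣-< {B} {δ} a b 0<B a≤B b<δ = begin-strict
  ℚ.∣ a ℚ.* b ∣        ≡⟨ ℚ.∣p*q∣≡∣p∣*∣q∣ a b ⟩
  ℚ.∣ a ∣ ℚ.* ℚ.∣ b ∣  ≤⟨ ℚ.*-monoʳ-≤-nonNeg ℚ.∣ b ∣ {{ℚ.nonNegative (ℚ.0≤∣p∣ b)}} a≤B ⟩
  B ℚ.* ℚ.∣ b ∣        <⟨ ℚ.*-monoʳ-<-pos B {{ℚ.positive 0<B}} b<δ ⟩
  B ℚ.* δ              ∎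
  where open ℚ.≤-Reasoning

*-cauchy : ∀ x y → Cauchy x → Cauchy y → Cauchy (λ n → x n ℚ.* y n)
*-cauchy x y cx cy ε 0<ε
  with bounded x cx | bounded y cy
... | B , 0<B , x≤B | C , 0<C , y≤C
  with scale 0<B (half-pos 0<ε) | scale 0<C (half-pos 0<ε)
... | δ , 0<δ , Bδ | η , 0<η , Cη
  with cx η 0<η | cy δ 0<δ
... | M , p | N , q = M ⊔ N , λ m n m≥ n≥ → begin-strict
  ℚ.∣ x m ℚ.* y m ℚ.- x n ℚ.* y n ∣
    ≡⟨ cong ℚ.∣_∣ (S.solve 4 (λ a b c d →
         a S.:* b S.:- c S.:* d S.:= a S.:* (b S.:- d) S.:+ d S.:* (a S.:- c))
         refl (x m) (y m) (x n) (y n)) ⟩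
  ℚ.∣ x m ℚ.* (y m ℚ.- y n) ℚ.+ y n ℚ.* (x m ℚ.- x n) ∣
    ≤⟨ ℚ.∣p+q∣≤∣p∣+∣q∣ (x m ℚ.* (y m ℚ.- y n)) (y n ℚ.* (x m ℚ.- x n)) ⟩
  ℚ.∣ x m ℚ.* (y m ℚ.- y n) ∣ ℚ.+ ℚ.∣ y n ℚ.* (x m ℚ.- x n) ∣
    <⟨ ℚ.+-mono-<
         (∣*∣-< (x m) (y m ℚ.- y n) 0<B (x≤B m)
           (q m n (ℕ.m⊔n≤o⇒n≤o M N m≥) (ℕ.m⊔n≤o⇒n≤o M N n≥)))
         (∣*∣-< (y n) (x m ℚ.- x n) 0<C (y≤C n)
           (p m n (ℕ.m⊔n≤o⇒m≤o M N m≥) (ℕ.m⊔n≤o⇒m≤o M N n≥))) ⟩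
  B ℚ.* δ ℚ.+ C ℚ.* η
    ≡⟨ cong₂ ℚ._+_ Bδ Cη ⟩
  ½ ℚ.* ε ℚ.+ ½ ℚ.* ε
    ≡⟨ halves ε ⟩
  ε ∎
  where open ℚ.≤-Reasoning

infixl 6 _+_
infixl 7 _*_

_+_ : ℝ → ℝ → ℝ
x + y = real (λ n → seq x n ℚ.+ seq y n) (+-cauchy (seq x) (seq y) (cauchy x) (cauchy y))

_*_ : ℝ → ℝ → ℝ
x * y = real (λ n → seq x n ℚ.* seq y n) (*-cauchy (seq x) (seq y) (cauchy x) (cauchy y))

fromℚ : ℚ → ℝ
fromℚ q = real (λ _ → q) λ ε 0<ε →
  0 , λ _ _ _ _ → subst (ℚ._< ε) (sym (cong ℚ.∣_∣ (ℚ.+-inverseʳ q))) 0<ε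

fromℤ : ℤ → ℝ
fromℤ z = fromℚ (z ℚ./ 1)

0ℝ : ℝ
0ℝ = fromℚ 0ℚ

Matrix : Set → ℕ → Set
Matrix A n = Fin n → Fin n → A

Σℝ : ∀ {n} → Vector ℝ n → ℝ
Σℝ = foldr _+_ 0ℝ

_*ᵥ_ : ∀ {n} → Matrix ℝ n → Vector ℝ n → Vector ℝ n
(M *ᵥ v) i = Σℝ λ j → M i j * v j

IsEigenvalue : ∀ {n} → Matrix ℝ n → ℝ → Set
IsEigenvalue {n} M ρ = ∃ λ (v : Vector ℝ n) →
  ¬ (∀ i → v i ≈ 0ℝ) × (∀ i → (M *ᵥ v) i ≈ ρ * v i)

IsLargestEigenvalue : ∀ {n} → Matrix ℝ n → ℝ → Set
IsLargestEigenvalue M ρ =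
  IsEigenvalue M ρ × (∀ σ → IsEigenvalue M σ → σ ≤ ρ)

record Graph (n : ℕ) : Set where
  field
    adj     : Fin n → Fin n → Bool
    adj-sym : ∀ i j → adj i j ≡ adj j i
    no-loop : ∀ i → adj i i ≡ false

open Graph public

neighbours : ∀ {n} → Graph n → Fin n → Subset n
neighbours G i = tabulate (adj G i)

degree : ∀ {n} → Graph n → Fin n → ℕ
degree G i = ∣ neighbours G i ∣

numEdges : ∀ {n} → Graph n → ℕ
numEdges {n} G = length (filterᵇ (λ (i , j) → ⌊ i <? j ⌋ ∧ adj G i j)
                                 (cartesianProduct (allFin n) (allFin n)))

adjacencyMatrix : ∀ {n} → Graph n → Matrix ℤ n
adjacencyMatrix G i j = if adj G i j then 1ℤ else 0ℤ

degreeMatrix : ∀ {n} → Graph n → Matrix ℤ n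
degreeMatrix G i j = if ⌊ i ≟ᶠ j ⌋ then + degree G i else 0ℤ

laplacian : ∀ {n} → Graph n → Matrix ℤ n
laplacian G i j = degreeMatrix G i j -ℤ adjacencyMatrix G i j

-- "ρ = λ₁(G)", as a relation: such a ρ is unique up to _≈_, and for n > 0 it
-- exists classically by the spectral theorem, but no function computing it is
-- defined here.
_isλ₁Of_ : ∀ {n} → ℝ → Graph n → Set
ρ isλ₁Of G = IsLargestEigenvalue (λ i j → fromℤ (laplacian G i j)) ρ

LEGM : ∀ {n} → Graph n → Set
LEGM {n} G = ∀ (H : Graph n) → numEdges H ≡ numEdges G →
  ∀ ρ σ → ρ isλ₁Of G → σ isλ₁Of H → ρ ≤ σ

K : ∀ r → Graph r
K r = record
  { adj     = λ i j → not ⌊ i ≟ᶠ j ⌋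
  ; adj-sym = symm
  ; no-loop = irr
  }
  where
  symm : ∀ (i j : Fin r) → not ⌊ i ≟ᶠ j ⌋ ≡ not ⌊ j ≟ᶠ i ⌋
  symm i j with i ≟ᶠ j | j ≟ᶠ i
  ... | yes _ | yes _ = refl
  ... | no  _ | no  _ = refl
  ... | yes p | no ¬q = contradiction (sym p) ¬q
  ... | no ¬p | yes q = contradiction (sym q) ¬p
  irr : ∀ (i : Fin r) → not ⌊ i ≟ᶠ i ⌋ ≡ false
  irr i with i ≟ᶠ i
  ... | yes _ = refl
  ... | no ¬p = contradiction refl ¬p

infixr 6 _∪_

_∪_ : ∀ {a b} → Graph a → Graph b → Graph (a +ℕ b)
_∪_ {a} {b} G H = record
  { adj     = λ i j → adj⊎ (splitAt a i) (splitAt a j)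
  ; adj-sym = λ i j → symm (splitAt a i) (splitAt a j)
  ; no-loop = λ i → irr (splitAt a i)
  }
  where
  adj⊎ : Fin a ⊎ Fin b → Fin a ⊎ Fin b → Bool
  adj⊎ (inj₁ i) (inj₁ j) = adj G i j
  adj⊎ (inj₂ i) (inj₂ j) = adj H i j
  adj⊎ _        _        = false

  symm : ∀ s t → adj⊎ s t ≡ adj⊎ t s
  symm (inj₁ i) (inj₁ j) = adj-sym G i j
  symm (inj₂ i) (inj₂ j) = adj-sym H i j
  symm (inj₁ i) (inj₂ j) = refl
  symm (inj₂ i) (inj₁ j) = refl

  irr : ∀ s → adj⊎ s s ≡ false
  irr (inj₁ i) = no-loop G i
  irr (inj₂ i) = no-loop H i

⋃K : (ns : List ℕ) → Graph (sum ns)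
⋃K []       = K 0
⋃K (n ∷ ns) = K n ∪ ⋃K ns

sum-nonZero : ∀ {n ns} → All NonZero (n ∷ ns) → NonZero (sum (n ∷ ns))
sum-nonZero {zero}  (record { nonZero = () } ∷ _)
sum-nonZero {suc _} _ = _

-- Write S for the sum of the nᵢ².  By the handshake lemma every H with as many
-- edges as G has degree sum S - n > (n₁ - 2) n, hence a vertex v of degree d with
-- d + 1 ≥ n₁.  If n₁ = 1 both graphs are edgeless.  Otherwise d > 0, and the test
-- vector with entry d at v and -1 at its neighbours has Rayleigh quotient at least
-- d + 1, while the Rayleigh quotients of G are at most n₁.
--
-- It remains to find an eigenvalue of L(H) above that Rayleigh quotient.  Over ℚ
-- positive semidefiniteness is decidable by elimination, so the infimum μ of the
-- rational t with t I - L(H) semidefinite is a Cauchy real.  If μ I - L(H) had no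
-- kernel, the same elimination over ℝ would make t I - L(H) definite with a uniform
-- constant for t near μ, contradicting the choice of μ.  The case distinctions on
-- real numbers are only available under double negation, which is harmless because
-- the goal ρ ≤ σ is a negative statement (≤ʳ-intro).

module Submission where

open import Defs renaming (_+_ to _+ʳ_; _*_ to _*ʳ_; _≤_ to _≤ʳ_)
open import Algebra.Bundles using (CommutativeRing)
open import Data.Bool using (Bool; true; false; _∧_; if_then_else_)
open import Data.Fin using (Fin; zero; suc; _↑ˡ_; _↑ʳ_) renaming (_≟_ to _≟ᶠ_)
import Data.Fin.Properties as Fin
open import Data.Fin.Subset using () renaming (∣_∣ to ∣_∣ˢ)
open import Data.Integer as ℤ using (+≤+)
import Data.Integer.Properties as ℤ
open import Data.List as List using (List; []; _∷_; length; filterᵇ; cartesianProduct; allFin)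
open import Data.List.Relation.Unary.All using (All; []; _∷_)
open import Data.List.Relation.Unary.Linked using (Linked)
open import Data.List.Relation.Unary.Linked.Properties using (Linked⇒All)
open import Data.Nat as ℕ using (ℕ; zero; suc; NonZero; _≥_; _^_)
open import Data.Nat.Combinatorics using (_C_; nCk+nC[k+1]≡[n+1]C[k+1]; nC1≡n)
open import Data.Nat.ListAction using (sum)
import Data.Nat.Properties as ℕ
open import Data.Nat.Tactic.RingSolver using (solve-∀)
open import Data.Product using (∃; _×_; _,_; proj₁; proj₂)
open import Data.Rational hiding (NonZero; _≥_)
import Data.Rational.Properties as ℚ
import Data.Rational.Solver as ℚSolver
open import Data.Rational.Unnormalised as ℚᵘ using (mkℚᵘ; *≡*; *≤*; *<*)
import Data.Rational.Unnormalised.Properties as ℚᵘ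
open import Data.Sum using (_⊎_; inj₁; inj₂)
import Data.Vec as Vec
open import Data.Vec.Functional using (Vector; tail) renaming (_∷_ to _∷ᵛ_)
open import Function using (_∘_; _$_)
open import Relation.Binary.Definitions using (tri<; tri≈; tri>)
open import Relation.Binary.PropositionalEquality
open import Relation.Nullary using (¬_; Dec; yes; no; contradiction; ¬?)
open import Relation.Nullary.Decidable using (isYes; decidable-stable)

open import Algebra.Properties.Semiring.Sum
  (CommutativeRing.semiring ℚ.+-*-commutativeRing)
  using (sum-cong-≗; ∑-distrib-+; ∑-comm; *-distribˡ-sum)
  renaming (sum to ∑)
open ℚSolver.+-*-Solver

-- Rational inequalities

-- `IsLargestEigenvalue` compares `σ` with eigenvalues only, so a Rayleigh quotient of H says
-- nothing about `σ` until it sits below a genuine eigenvalue. On the side of G the given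
-- eigenvector of `ρ` is enough: a rational gap between `ρ` and the bound n₁ for the quadratic form
-- makes every entry of that vector null. A real matrix is handled through its rational stages, and
-- definiteness of a real matrix becomes a statement about all late stages with one common constant.
-- Two choices follow. Elimination avoids division, whence the Schur complement multiplied by its
-- pivot. And `μ` is approximated from above, so that every stage of μ I - L(H) is exactly
-- semidefinite and not merely so in the limit.

0≤+ : ∀ {p q} → 0ℚ ≤ p → 0ℚ ≤ q → 0ℚ ≤ p + q
0≤+ = ℚ.+-mono-≤

0≤* : ∀ {p q} → 0ℚ ≤ p → 0ℚ ≤ q → 0ℚ ≤ p * q
0≤* {p} {q} 0≤p 0≤q =
  ℚ.nonNegative⁻¹ (p * q)
    {{ℚ.nonNeg*nonNeg⇒nonNeg p {{nonNegative 0≤p}} q {{nonNegative 0≤q}}}}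

0<* : ∀ {p q} → 0ℚ < p → 0ℚ < q → 0ℚ < p * q
0<* {p} {q} 0<p 0<q =
  ℚ.positive⁻¹ (p * q) {{ℚ.pos*pos⇒pos p {{positive 0<p}} q {{positive 0<q}}}}

0<+ : ∀ {p q} → 0ℚ < p → 0ℚ ≤ q → 0ℚ < p + q
0<+ = ℚ.+-mono-<-≤

0≤² : ∀ p → 0ℚ ≤ p * p
0≤² p with ℚ.≤-total 0ℚ p
... | inj₁ 0≤p = 0≤* 0≤p 0≤p
... | inj₂ p≤0 = ℚ.nonNegative⁻¹ (p * p)
  {{ℚ.nonPos*nonPos⇒nonPos p {{nonPositive p≤0}} p {{nonPositive p≤0}}}}

0<² : ∀ {p} → p ≢ 0ℚ → 0ℚ < p * p
0<² {p} p≢0 with ℚ.<-cmp p 0ℚ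
... | tri< p<0 _ _ = ℚ.positive⁻¹ (p * p)
  {{ℚ.neg*neg⇒pos p {{negative p<0}} p {{negative p<0}}}}
... | tri≈ _ p≡0 _ = contradiction p≡0 p≢0
... | tri> _ _ 0<p = 0<* 0<p 0<p

-- Inequalities are proved by certificates: a visibly nonnegative difference `d` and a ring identity
-- left to the solver. The long terms further on are such differences.
≤-by : ∀ {p q} d → 0ℚ ≤ d → p + d ≡ q → p ≤ q
≤-by {p} d 0≤d refl = subst (_≤ p + d) (ℚ.+-identityʳ p) (ℚ.+-monoʳ-≤ p 0≤d)

<-by : ∀ {p q} d → 0ℚ < d → p + d ≡ q → p < q
<-by {p} d 0<d refl = subst (_< p + d) (ℚ.+-identityʳ p) (ℚ.+-monoʳ-< p 0<d)

p≤q⇒0≤q-p : ∀ {p q} → p ≤ q → 0ℚ ≤ q - p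
p≤q⇒0≤q-p {p} {q} p≤q = subst (_≤ q - p) (ℚ.+-inverseʳ p) (ℚ.+-monoˡ-≤ (- p) p≤q)

p<q⇒0<q-p : ∀ {p q} → p < q → 0ℚ < q - p
p<q⇒0<q-p {p} {q} p<q = subst (_< q - p) (ℚ.+-inverseʳ p) (ℚ.+-monoˡ-< (- p) p<q)

0≤*-cancelˡ : ∀ {p q} → 0ℚ < p → 0ℚ ≤ p * q → 0ℚ ≤ q
0≤*-cancelˡ {p} {q} 0<p 0≤pq =
  ℚ.*-cancelˡ-≤-pos p {{positive 0<p}} (subst (_≤ p * q) (sym (ℚ.*-zeroʳ p)) 0≤pq)

sum-nonneg : ∀ {n} {f : Vector ℚ n} → (∀ i → 0ℚ ≤ f i) → 0ℚ ≤ ∑ f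
sum-nonneg {zero}  h = ℚ.≤-refl
sum-nonneg {suc n} h = 0≤+ (h zero) (sum-nonneg (h ∘ suc))

sum-mono : ∀ {n} {f g : Vector ℚ n} → (∀ i → f i ≤ g i) → ∑ f ≤ ∑ g
sum-mono {zero}  h = ℚ.≤-refl
sum-mono {suc n} h = ℚ.+-mono-≤ (h zero) (sum-mono (h ∘ suc))

-- Rational quadratic forms

infix 8 _·_
infixr 9 _⊡_

_·_ : ∀ {n} → Vector ℚ n → Vector ℚ n → ℚ
x · y = ∑ λ i → x i * y i

_⊡_ : ∀ {n} → Matrix ℚ n → Vector ℚ n → Vector ℚ n
(A ⊡ x) i = A i · x

Q : ∀ {n} → Matrix ℚ n → Vector ℚ n → ℚ
Q A x = x · (A ⊡ x)

Symmetric : ∀ {n} → Matrix ℚ n → Set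
Symmetric A = ∀ i j → A i j ≡ A j i

PSD : ∀ {n} → Matrix ℚ n → Set
PSD A = ∀ x → 0ℚ ≤ Q A x

·-comm : ∀ {n} (x y : Vector ℚ n) → x · y ≡ y · x
·-comm x y = sum-cong-≗ λ i → ℚ.*-comm (x i) (y i)

·-congʳ : ∀ {n} (x : Vector ℚ n) {y z : Vector ℚ n} → (∀ i → y i ≡ z i) → x · y ≡ x · z
·-congʳ x h = sum-cong-≗ λ i → cong (x i *_) (h i)

-- Many identities further on carry factors `1ℚ *` and `- 1ℚ *` in order to match this shape.
·-linearʳ : ∀ {n} (x y z : Vector ℚ n) p q →
            x · (λ i → p * y i + q * z i) ≡ p * x · y + q * x · z
·-linearʳ {zero} x y z p q =
  solve 2 (λ p q → con 0ℚ := p :* con 0ℚ :+ q :* con 0ℚ) refl p q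
·-linearʳ {suc n} x y z p q =
  trans (cong (x zero * (p * y zero + q * z zero) +_) (·-linearʳ (x ∘ suc) (y ∘ suc) (z ∘ suc) p q))
        (solve 7 (λ x₀ y₀ z₀ p q s t →
           x₀ :* (p :* y₀ :+ q :* z₀) :+ (p :* s :+ q :* t)
             := p :* (x₀ :* y₀ :+ s) :+ q :* (x₀ :* z₀ :+ t))
         refl (x zero) (y zero) (z zero) p q ((x ∘ suc) · (y ∘ suc)) ((x ∘ suc) · (z ∘ suc)))

·-scaleʳ : ∀ {n} (x y : Vector ℚ n) c → x · (λ i → c * y i) ≡ c * x · y
·-scaleʳ x y c =
  trans (sum-cong-≗ λ i → solve 3 (λ x y c → x :* (c :* y) := c :* (x :* y)) refl (x i) (y i) c)
        (sym (*-distribˡ-sum c (λ i → x i * y i)))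

Q-scale : ∀ {n} (A : Matrix ℚ n) x c → Q A (λ i → c * x i) ≡ c * (c * Q A x)
Q-scale A x c = begin
  (λ i → c * x i) · (A ⊡ (λ i → c * x i))  ≡⟨ ·-congʳ (λ i → c * x i) (λ i → ·-scaleʳ (A i) x c) ⟩
  (λ i → c * x i) · (λ i → c * (A ⊡ x) i)  ≡⟨ ·-scaleʳ (λ i → c * x i) (A ⊡ x) c ⟩
  c * (λ i → c * x i) · (A ⊡ x)            ≡⟨ cong (c *_) (·-comm (λ i → c * x i) (A ⊡ x)) ⟩
  c * (A ⊡ x) · (λ i → c * x i)            ≡⟨ cong (c *_) (·-scaleʳ (A ⊡ x) x c) ⟩
  c * (c * (A ⊡ x) · x)                    ≡⟨ cong (λ t → c * (c * t)) (·-comm (A ⊡ x) x) ⟩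
  c * (c * Q A x)                          ∎
  where open ≡-Reasoning

0ᵛ : ∀ {n} → Vector ℚ n
0ᵛ _ = 0ℚ

-- Standard basis vectors; read as a matrix, the identity.
e : ∀ {n} → Fin n → Vector ℚ n
e zero    = 1ℚ ∷ᵛ 0ᵛ
e (suc i) = 0ℚ ∷ᵛ e i

·-0ᵛ : ∀ {n} (x : Vector ℚ n) → x · 0ᵛ ≡ 0ℚ
·-0ᵛ {zero}  x = refl
·-0ᵛ {suc n} x = cong₂ _+_ (ℚ.*-zeroʳ (x zero)) (·-0ᵛ (x ∘ suc))

·-e : ∀ {n} (x : Vector ℚ n) j → x · e j ≡ x j
·-e x zero    =
  trans (cong₂ _+_ (ℚ.*-identityʳ (x zero)) (·-0ᵛ (x ∘ suc))) (ℚ.+-identityʳ (x zero))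
·-e x (suc j) =
  trans (cong₂ _+_ (ℚ.*-zeroʳ (x zero)) (·-e (x ∘ suc) j)) (ℚ.+-identityˡ (x (suc j)))

Q-e : ∀ {n} (A : Matrix ℚ n) j → Q A (e j) ≡ A j j
Q-e A j = trans (·-comm (e j) (A ⊡ e j)) (trans (·-e (A ⊡ e j) j) (·-e (A j) j))

minor : ∀ {A : Set} {n} → Matrix A (suc n) → Matrix A n
minor A i j = A (suc i) (suc j)

row : ∀ {A : Set} {n} → Matrix A (suc n) → Vector A n
row A j = A zero (suc j)

-- A₀₀ times the Schur complement, so that no division is needed.
schur : ∀ {n} → Matrix ℚ (suc n) → Matrix ℚ n
schur A i j = A zero zero * minor A i j + - 1ℚ * (row A i * row A j)

schur-sym : ∀ {n} (A : Matrix ℚ (suc n)) → Symmetric A → Symmetric (schur A)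
schur-sym A A-sym i j =
  cong₂ (λ p q → A zero zero * p + - 1ℚ * q)
    (A-sym (suc i) (suc j)) (ℚ.*-comm (row A i) (row A j))

⊡-schur : ∀ {n} (A : Matrix ℚ (suc n)) y i →
          (schur A ⊡ y) i ≡ A zero zero * (minor A ⊡ y) i + - (row A · y) * row A i
⊡-schur A y i = begin
  schur A i · y
    ≡⟨ ·-comm (schur A i) y ⟩
  y · schur A i
    ≡⟨ ·-congʳ y (λ j → solve 4 (λ a m b c → a :* m :+ con (- 1ℚ) :* (b :* c) := a :* m :+ (:- b) :* c)
         refl (A zero zero) (minor A i j) (row A i) (row A j)) ⟩
  y · (λ j → A zero zero * minor A i j + - row A i * row A j)
    ≡⟨ ·-linearʳ y (minor A i) (row A) (A zero zero) (- row A i) ⟩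
  A zero zero * y · minor A i + - row A i * y · row A
    ≡⟨ cong₂ (λ s t → A zero zero * s + - row A i * t) (·-comm y (minor A i)) (·-comm y (row A)) ⟩
  A zero zero * (minor A ⊡ y) i + - row A i * row A · y
    ≡⟨ cong (A zero zero * (minor A ⊡ y) i +_)
         (solve 2 (λ b r → (:- b) :* r := (:- r) :* b) refl (row A i) (row A · y)) ⟩
  A zero zero * (minor A ⊡ y) i + - (row A · y) * row A i
    ∎
  where open ≡-Reasoning

Q-schur : ∀ {n} (A : Matrix ℚ (suc n)) y →
          Q (schur A) y ≡ A zero zero * Q (minor A) y - row A · y * row A · y
Q-schur A y = begin
  y · (schur A ⊡ y)
    ≡⟨ ·-congʳ y (⊡-schur A y) ⟩
  y · (λ i → A zero zero * (minor A ⊡ y) i + - (row A · y) * row A i)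
    ≡⟨ ·-linearʳ y (minor A ⊡ y) (row A) (A zero zero) (- (row A · y)) ⟩
  A zero zero * Q (minor A) y + - (row A · y) * y · row A
    ≡⟨ cong (A zero zero * Q (minor A) y +_)
         (trans (cong (- (row A · y) *_) (·-comm y (row A)))
                (sym (ℚ.neg-distribˡ-* (row A · y) (row A · y)))) ⟩
  A zero zero * Q (minor A) y - row A · y * row A · y
    ∎
  where open ≡-Reasoning

module _ {n} (A : Matrix ℚ (suc n)) (A-sym : Symmetric A) where

  private
    a = A zero zero
    b = row A

  ⊡-cons : ∀ x₀ y i → (A ⊡ (x₀ ∷ᵛ y)) (suc i) ≡ x₀ * b i + 1ℚ * (minor A ⊡ y) i
  ⊡-cons x₀ y i = begin
    A (suc i) zero * x₀ + minor A i · y ≡⟨ cong (λ t → t * x₀ + minor A i · y) (A-sym (suc i) zero) ⟩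
    b i * x₀ + minor A i · y            ≡⟨ cong₂ _+_ (ℚ.*-comm (b i) x₀) (sym (ℚ.*-identityˡ _)) ⟩
    x₀ * b i + 1ℚ * minor A i · y       ∎
    where open ≡-Reasoning

  Q-cons : ∀ x₀ y → Q A (x₀ ∷ᵛ y) ≡ x₀ * (a * x₀ + b · y) + (x₀ * b · y + Q (minor A) y)
  Q-cons x₀ y = cong (x₀ * (a * x₀ + b · y) +_) $ begin
    y · (λ i → (A ⊡ (x₀ ∷ᵛ y)) (suc i))               ≡⟨ ·-congʳ y (⊡-cons x₀ y) ⟩
    y · (λ i → x₀ * b i + 1ℚ * (minor A ⊡ y) i)      ≡⟨ ·-linearʳ y b (minor A ⊡ y) x₀ 1ℚ ⟩
    x₀ * y · b + 1ℚ * Q (minor A) y                  ≡⟨ cong₂ _+_ (cong (x₀ *_) (·-comm y b)) (ℚ.*-identityˡ _) ⟩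
    x₀ * b · y + Q (minor A) y                       ∎
    where open ≡-Reasoning

  -- The square is completed in the first variable after multiplying by `a`, in place of dividing by
  -- it. For positive `a` it makes semidefiniteness of `schur A` sufficient for that of `A`.
  complete-square : ∀ x₀ y →
    a * Q A (x₀ ∷ᵛ y) ≡ (a * x₀ + b · y) * (a * x₀ + b · y) + Q (schur A) y
  complete-square x₀ y =
    trans (cong (a *_) (Q-cons x₀ y))
      (trans (solve 4 (λ a x r q →
                a :* (x :* (a :* x :+ r) :+ (x :* r :+ q))
                  := (a :* x :+ r) :* (a :* x :+ r) :+ (a :* q :- r :* r))
              refl a x₀ (b · y) (Q (minor A) y))
        (cong ((a * x₀ + b · y) * (a * x₀ + b · y) +_) (sym (Q-schur A y))))

  -- The vector (-(b · y) / a, y), at which the square in `complete-square` vanishes, rescaled by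
  -- `a`.
  schur-lift : Vector ℚ n → Vector ℚ (suc n)
  schur-lift y = - (b · y) ∷ᵛ (λ i → a * y i)

  Q-schur-lift : ∀ y → Q A (schur-lift y) ≡ a * Q (schur A) y
  Q-schur-lift y = begin
    Q A (schur-lift y)
      ≡⟨ Q-cons (- r) (λ i → a * y i) ⟩
    - r * (a * - r + b · (λ i → a * y i)) + (- r * b · (λ i → a * y i) + Q (minor A) (λ i → a * y i))
      ≡⟨ cong₂ (λ s t → - r * (a * - r + s) + (- r * s + t)) (·-scaleʳ b y a) (Q-scale (minor A) y a) ⟩
    - r * (a * - r + a * r) + (- r * (a * r) + a * (a * Q (minor A) y))
      ≡⟨ solve 3 (λ a r q →
           (:- r) :* (a :* (:- r) :+ a :* r) :+ ((:- r) :* (a :* r) :+ a :* (a :* q))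
             := a :* (a :* q :- r :* r)) refl a r (Q (minor A) y) ⟩
    a * (a * Q (minor A) y - r * r)
      ≡⟨ cong (a *_) (Q-schur A y) ⟨
    a * Q (schur A) y
      ∎
    where
    open ≡-Reasoning
    r = b · y

  schur-psd : 0ℚ < a → PSD A → PSD (schur A)
  schur-psd 0<a psd y = 0≤*-cancelˡ 0<a (subst (0ℚ ≤_) (Q-schur-lift y) (psd (schur-lift y)))

  -- The form at (- τ, e j). The parameter τ is free: with τ large and a τ² bounded, the inequality
  -- squeezes `b j`, which is how a null pivot will force a null row.
  psd-entry : PSD A → ∀ τ j → τ * b j + τ * b j ≤ a * (τ * τ) + minor A j j
  psd-entry psd τ j = ≤-by (Q A (- τ ∷ᵛ e j)) (psd (- τ ∷ᵛ e j)) (begin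
    τ * b j + τ * b j + Q A (- τ ∷ᵛ e j)
      ≡⟨ cong (τ * b j + τ * b j +_) (Q-cons (- τ) (e j)) ⟩
    τ * b j + τ * b j + (- τ * (a * - τ + b · e j) + (- τ * b · e j + Q (minor A) (e j)))
      ≡⟨ cong₂ (λ r q → τ * b j + τ * b j + (- τ * (a * - τ + r) + (- τ * r + q)))
           (·-e b j) (Q-e (minor A) j) ⟩
    τ * b j + τ * b j + (- τ * (a * - τ + b j) + (- τ * b j + minor A j j))
      ≡⟨ solve 4 (λ a b τ m →
           τ :* b :+ τ :* b :+ ((:- τ) :* (a :* (:- τ) :+ b) :+ ((:- τ) :* b :+ m))
             := a :* (τ :* τ) :+ m) refl a (b j) τ (minor A j j) ⟩
    a * (τ * τ) + minor A j j
      ∎)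
    where open ≡-Reasoning

Negative-or-PSD : ∀ {n} (A : Matrix ℚ n) → Set
Negative-or-PSD A = (∃ λ x → Q A x < 0ℚ) ⊎ PSD A

-- Elimination by the sign of the pivot. A negative pivot is itself a witness, and a positive one
-- reduces to the Schur complement. A zero pivot with a zero row drops out; with a nonzero row it
-- makes the form indefinite.
psd? : ∀ {n} (A : Matrix ℚ n) → Symmetric A → Negative-or-PSD A
psd? {zero}  A A-sym = inj₂ λ _ → ℚ.≤-refl
psd? {suc n} A A-sym with ℚ.<-cmp (A zero zero) 0ℚ
... | tri< a<0 _ _ = inj₁ (e zero , subst (_< 0ℚ) (sym (Q-e A zero)) a<0)
... | tri> _ _ 0<a with psd? (schur A) (schur-sym A A-sym)
...   | inj₁ (y , q<0) = inj₁ (schur-lift A A-sym y ,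
        subst₂ _<_ (sym (Q-schur-lift A A-sym y)) (ℚ.*-zeroʳ (A zero zero))
          (ℚ.*-monoʳ-<-pos (A zero zero) {{positive 0<a}} q<0))
...   | inj₂ psd = inj₂ λ x → 0≤*-cancelˡ 0<a
        (subst (0ℚ ≤_) (sym (complete-square A A-sym (x zero) (tail x)))
          (0≤+ (0≤² (A zero zero * x zero + row A · tail x)) (psd (tail x))))
psd? {suc n} A A-sym | tri≈ _ a≡0 _ with Fin.any? (λ j → ¬? (row A j ℚ.≟ 0ℚ))
... | yes (j , b≢0) = inj₁ (x₀ ∷ᵛ y , <-by (β * β) (0<² b≢0) (begin
  Q A (x₀ ∷ᵛ y) + β * β
    ≡⟨ cong (_+ β * β) (Q-cons A A-sym x₀ y) ⟩
  x₀ * (A zero zero * x₀ + row A · y) + (x₀ * row A · y + Q (minor A) y) + β * β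
    ≡⟨ cong₂ (λ a r → x₀ * (a * x₀ + r) + (x₀ * r + Q (minor A) y) + β * β) a≡0
         (trans (·-scaleʳ (row A) (e j) β) (cong (β *_) (·-e (row A) j))) ⟩
  x₀ * (0ℚ * x₀ + β * β) + (x₀ * (β * β) + Q (minor A) y) + β * β
    ≡⟨ cong (λ q → x₀ * (0ℚ * x₀ + β * β) + (x₀ * (β * β) + q) + β * β)
         (trans (Q-scale (minor A) (e j) β) (cong (λ q → β * (β * q)) (Q-e (minor A) j))) ⟩
  x₀ * (0ℚ * x₀ + β * β) + (x₀ * (β * β) + β * (β * m)) + β * β
    ≡⟨ solve 2 (λ β m → let x₀ = :- (con ½ :* (m :+ con 1ℚ)) in
         x₀ :* (con 0ℚ :* x₀ :+ β :* β) :+ (x₀ :* (β :* β) :+ β :* (β :* m)) :+ β :* β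
           := con 0ℚ) refl β m ⟩
  0ℚ
    ∎))
  where
  open ≡-Reasoning
  β = row A j
  m = minor A j j
  -- At pivot 0 the form is β² (2 x₀ + m), and this choice makes it - β².
  x₀ = - (½ * (m + 1ℚ))
  y : Vector ℚ n
  y i = β * e j i
... | no  b≡0 with psd? (minor A) (λ i j → A-sym (suc i) (suc j))
...   | inj₁ (y , q<0) = inj₁ (0ℚ ∷ᵛ y , subst (_< 0ℚ) (sym eq) q<0)
  where
  eq : Q A (0ℚ ∷ᵛ y) ≡ Q (minor A) y
  eq = trans (Q-cons A A-sym 0ℚ y)
    (solve 3 (λ a r q → con 0ℚ :* (a :* con 0ℚ :+ r) :+ (con 0ℚ :* r :+ q) := q) refl
      (A zero zero) (row A · y) (Q (minor A) y))
...   | inj₂ psd = inj₂ λ x → subst (0ℚ ≤_) (sym (eq x)) (psd (tail x))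
  where
  b·≡0 : ∀ y → row A · y ≡ 0ℚ
  b·≡0 y = trans (·-comm (row A) y)
    (trans (·-congʳ y λ j → decidable-stable (row A j ℚ.≟ 0ℚ) λ b≢0 → b≡0 (j , b≢0)) (·-0ᵛ y))
  eq : ∀ x → Q A x ≡ Q (minor A) (tail x)
  eq x = trans (Q-cons A A-sym (x zero) (tail x))
    (trans (cong₂ (λ a r → x zero * (a * x zero + r) + (x zero * r + Q (minor A) (tail x))) a≡0 (b·≡0 (tail x)))
      (solve 2 (λ x q → x :* (con 0ℚ :* x :+ con 0ℚ) :+ (x :* con 0ℚ :+ q) := q) refl
        (x zero) (Q (minor A) (tail x))))

-- This is what carries kernel vectors of the Schur complement to kernel vectors of `A`.
⊡-schur-lift : ∀ {n} (A : Matrix ℚ (suc n)) (A-sym : Symmetric A) y →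
  (A ⊡ schur-lift A A-sym y) zero ≡ 0ℚ ×
  (∀ i → (A ⊡ schur-lift A A-sym y) (suc i) ≡ (schur A ⊡ y) i)
⊡-schur-lift A A-sym y = head≡ , tail≡
  where
  open ≡-Reasoning
  a = A zero zero
  b = row A
  head≡ : a * - (b · y) + b · (λ j → a * y j) ≡ 0ℚ
  head≡ = trans (cong (a * - (b · y) +_) (·-scaleʳ b y a))
    (solve 2 (λ a r → a :* (:- r) :+ a :* r := con 0ℚ) refl a (b · y))
  tail≡ : ∀ i → (A ⊡ schur-lift A A-sym y) (suc i) ≡ (schur A ⊡ y) i
  tail≡ i = begin
    (A ⊡ schur-lift A A-sym y) (suc i)
      ≡⟨ ⊡-cons A A-sym (- (b · y)) (λ j → a * y j) i ⟩
    - (b · y) * b i + 1ℚ * minor A i · (λ j → a * y j)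
      ≡⟨ cong (λ t → - (b · y) * b i + 1ℚ * t) (·-scaleʳ (minor A i) y a) ⟩
    - (b · y) * b i + 1ℚ * (a * minor A i · y)
      ≡⟨ solve 4 (λ r b a m → (:- r) :* b :+ con 1ℚ :* (a :* m) := a :* m :+ (:- r) :* b) refl
           (b · y) (b i) a (minor A i · y) ⟩
    a * minor A i · y + - (b · y) * b i
      ≡⟨ ⊡-schur A y i ⟨
    (schur A ⊡ y) i
      ∎

∣p∣²≡p² : ∀ p → ∣ p ∣ * ∣ p ∣ ≡ p * p
∣p∣²≡p² p = trans (sym (ℚ.∣p*q∣≡∣p∣*∣q∣ p p)) (ℚ.0≤p⇒∣p∣≡p (0≤² p))

∣p∣≤B⇒p²≤B² : ∀ {p B} → ∣ p ∣ ≤ B → p * p ≤ B * B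
∣p∣≤B⇒p²≤B² {p} {B} ∣p∣≤B = ≤-by ((B - ∣ p ∣) * (B + ∣ p ∣))
  (0≤* (p≤q⇒0≤q-p ∣p∣≤B) (0≤+ (ℚ.≤-trans (ℚ.0≤∣p∣ p) ∣p∣≤B) (ℚ.0≤∣p∣ p)))
  (trans (cong (_+ (B - ∣ p ∣) * (B + ∣ p ∣)) (sym (∣p∣²≡p² p)))
    (solve 2 (λ p B → p :* p :+ (B :- p) :* (B :+ p) := B :* B) refl ∣ p ∣ B))

-- Quantitative positive definiteness passes from the Schur complement
-- q″ = a q − (a x₀ + r)² to q itself.
module _ {a x₀ r X κ M c q″ : ℚ} where

  private
    D = c + c + (κ + κ) + M * M
    s = a * x₀ + r

  definite-lift : 0ℚ ≤ κ → 0ℚ ≤ c → 0ℚ ≤ a → a ≤ M → 0ℚ ≤ X → r * r ≤ κ * X → c * X ≤ q″ →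
                  a * (c * a * (x₀ * x₀ + X)) ≤ D * (s * s + q″)
  definite-lift 0≤κ 0≤c 0≤a a≤M 0≤X r²≤CX cX≤q″ = ≤-by
    -- Since a x₀ = s - r, (a x₀)² ≤ 2 s² + 2 r². Then r² ≤ κ X, a² ≤ M² and c X ≤ q″ produce the
    -- summands 2 c, 2 κ and M² of D.
    ((κ + κ + M * M) * (s * s) + c * ((s + r) * (s + r)) + D * (q″ - c * X)
      + (c * c + c * c) * X + (M - a) * (M + a) * (c * X) + (c + c) * (κ * X - r * r))
    (0≤+ (0≤+ (0≤+ (0≤+ (0≤+
      (0≤* (0≤+ (0≤+ 0≤κ 0≤κ) (0≤² M)) (0≤² s))
      (0≤* 0≤c (0≤² (s + r))))
      (0≤* (0≤+ (0≤+ (0≤+ 0≤c 0≤c) (0≤+ 0≤κ 0≤κ)) (0≤² M)) (p≤q⇒0≤q-p cX≤q″)))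
      (0≤* (0≤+ (0≤² c) (0≤² c)) 0≤X))
      (0≤* (0≤* (p≤q⇒0≤q-p a≤M) (0≤+ (ℚ.≤-trans 0≤a a≤M) 0≤a)) (0≤* 0≤c 0≤X)))
      (0≤* (0≤+ 0≤c 0≤c) (p≤q⇒0≤q-p r²≤CX)))
    (solve 8 (λ a x₀ r X κ M c q″ →
      let D = c :+ c :+ (κ :+ κ) :+ M :* M
          s = a :* x₀ :+ r
      in a :* (c :* a :* (x₀ :* x₀ :+ X)) :+
         ((κ :+ κ :+ M :* M) :* (s :* s) :+ c :* ((s :+ r) :* (s :+ r)) :+ D :* (q″ :- c :* X)
           :+ (c :* c :+ c :* c) :* X :+ (M :- a) :* (M :+ a) :* (c :* X) :+ (c :+ c) :* (κ :* X :- r :* r))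
         := D :* (s :* s :+ q″))
      refl a x₀ r X κ M c q″)

-- Kernels of real positive semidefinite matrices

at : ∀ {n} → Matrix ℝ n → ℕ → Matrix ℚ n
at A k i j = seq (A i j) k

atᵛ : ∀ {n} → Vector ℝ n → ℕ → Vector ℚ n
atᵛ v k i = seq (v i) k

seq-Σ : ∀ {n} (f : Vector ℝ n) k → seq (Σℝ f) k ≡ ∑ (λ i → seq (f i) k)
seq-Σ {zero}  f k = refl
seq-Σ {suc n} f k = cong (seq (f zero) k +_) (seq-Σ (f ∘ suc) k)

seq-*ᵥ : ∀ {n} (A : Matrix ℝ n) v i k → seq ((A *ᵥ v) i) k ≡ (at A k ⊡ atᵛ v k) i
seq-*ᵥ A v i k = seq-Σ (λ j → A i j *ʳ v j) k

≈0-resp : ∀ x y → (∀ k → seq x k ≡ seq y k) → x ≈ 0ℝ → y ≈ 0ℝ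
≈0-resp x y x≡y x≈0 ε 0<ε =
  let N , h = x≈0 ε 0<ε in
  N , λ k N≤k → subst (λ p → ∣ p - 0ℚ ∣ < ε) (x≡y k) (h k N≤k)

p-0≡p : ∀ p → p - 0ℚ ≡ p
p-0≡p = ℚ.+-identityʳ

p≤∣p∣ : ∀ p → p ≤ ∣ p ∣
p≤∣p∣ p with ℚ.≤-total 0ℚ p
... | inj₁ 0≤p = ℚ.≤-reflexive (sym (ℚ.0≤p⇒∣p∣≡p 0≤p))
... | inj₂ p≤0 = ℚ.≤-trans p≤0 (ℚ.0≤∣p∣ p)

∣∣<-intro : ∀ {p ε} → p < ε → - p < ε → ∣ p ∣ < ε
∣∣<-intro {p} p<ε -p<ε with ℚ.∣p∣≡p∨∣p∣≡-p p
... | inj₁ eq = subst (_< _) (sym eq) p<ε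
... | inj₂ eq = subst (_< _) (sym eq) -p<ε

Eventually : (ℕ → Set) → Set
Eventually P = ∃ λ N → ∀ k → N ℕ.≤ k → P k

infixr 2 _⊗_
_⊗_ : ∀ {P R : ℕ → Set} → Eventually P → Eventually R → Eventually λ k → P k × R k
(M , p) ⊗ (N , r) = M ℕ.⊔ N , λ k h →
  p k (ℕ.m⊔n≤o⇒m≤o M N h) , r k (ℕ.m⊔n≤o⇒n≤o M N h)

eventually-map : ∀ {P R : ℕ → Set} → (∀ {k} → P k → R k) → Eventually P → Eventually R
eventually-map f (N , p) = N , λ k h → f (p k h)

-- The constructive form of x > 0: one rational bound for all late terms.
BoundedBelow : ℝ → Set
BoundedBelow x = ∃ λ α → 0ℚ < α × Eventually λ k → α ≤ seq x k

-- Were one late term at least ε, the Cauchy property would keep all late terms above ε/2. Each such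
-- comparison is between rationals, hence decidable, so the negated hypothesis yields a positive
-- conclusion.
nonneg-null : ∀ x → Eventually (λ k → 0ℚ ≤ seq x k) → ¬ BoundedBelow x → x ≈ 0ℝ
nonneg-null x x≥0 ¬pos ε 0<ε = eventually-map small (cau ⊗ x≥0)
  where
  N = proj₁ (cauchy x (½ * ε) (half-pos 0<ε))
  near = proj₂ (cauchy x (½ * ε) (half-pos 0<ε))

  cau : Eventually λ k → N ℕ.≤ k
  cau = N , λ k h → h

  small : ∀ {k} → N ℕ.≤ k × 0ℚ ≤ seq x k → ∣ seq x k - 0ℚ ∣ < ε
  small {k} (N≤k , 0≤x) = subst (λ p → ∣ p ∣ < ε) (sym (p-0≡p (seq x k)))
    (subst (_< ε) (sym (ℚ.0≤p⇒∣p∣≡p 0≤x)) (ℚ.≰⇒> λ ε≤x →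
      ¬pos (½ * ε , half-pos 0<ε , N , λ m N≤m → bound m N≤m ε≤x)))
    where
    bound : ∀ m → N ℕ.≤ m → ε ≤ seq x k → ½ * ε ≤ seq x m
    bound m N≤m ε≤x = ≤-by ((½ * ε - (seq x k - seq x m)) + (seq x k - ε))
      (0≤+ (p≤q⇒0≤q-p (ℚ.≤-trans (p≤∣p∣ _) (ℚ.<⇒≤ (near k m N≤k N≤m)))) (p≤q⇒0≤q-p ε≤x))
      (solve 3 (λ ε xk xm → con ½ :* ε :+ ((con ½ :* ε :- (xk :- xm)) :+ (xk :- ε)) := xm)
        refl ε (seq x k) (seq x m))

cancel-null : ∀ a y → BoundedBelow a → a *ʳ y ≈ 0ℝ → y ≈ 0ℝ
cancel-null a y (α , 0<α , a≥α) ay≈0 ε 0<ε =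
  eventually-map small (a≥α ⊗ ay≈0 (α * ε) (0<* 0<α 0<ε))
  where
  small : ∀ {k} → α ≤ seq a k × ∣ seq a k * seq y k - 0ℚ ∣ < α * ε → ∣ seq y k - 0ℚ ∣ < ε
  small {k} (α≤a , ay<) = subst (λ p → ∣ p ∣ < ε) (sym (p-0≡p (seq y k)))
    (ℚ.*-cancelˡ-<-nonNeg α {{nonNegative (ℚ.<⇒≤ 0<α)}} (begin-strict
      α * ∣ seq y k ∣        ≤⟨ ℚ.*-monoʳ-≤-nonNeg ∣ seq y k ∣ {{nonNegative (ℚ.0≤∣p∣ (seq y k))}} α≤a ⟩
      seq a k * ∣ seq y k ∣  ≡⟨ cong (_* ∣ seq y k ∣) (ℚ.0≤p⇒∣p∣≡p (ℚ.≤-trans (ℚ.<⇒≤ 0<α) α≤a)) ⟨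
      ∣ seq a k ∣ * ∣ seq y k ∣  ≡⟨ ℚ.∣p*q∣≡∣p∣*∣q∣ (seq a k) (seq y k) ⟨
      ∣ seq a k * seq y k ∣  ≡⟨ cong ∣_∣ (p-0≡p (seq a k * seq y k)) ⟨
      ∣ seq a k * seq y k - 0ℚ ∣  <⟨ ay< ⟩
      α * ε                  ∎))
    where open ℚ.≤-Reasoning

Symmetricʳ : ∀ {n} → Matrix ℝ n → Set
Symmetricʳ A = ∀ k → Symmetric (at A k)

-- Its stage k is, by computation, `schur` of stage k; the explicit factor `- 1ℚ` in `schur` is
-- there to match.
schurʳ : ∀ {n} → Matrix ℝ (suc n) → Matrix ℝ n
schurʳ A i j = A zero zero *ʳ minor A i j +ʳ fromℚ (- 1ℚ) *ʳ (row A i *ʳ row A j)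

EventuallyPSD : ∀ {n} → Matrix ℝ n → Set
EventuallyPSD A = Eventually λ k → PSD (at A k)

-- The constant is common to all late stages; definiteness of each single stage could be lost in the
-- limit.
UniformlyPD : ∀ {n} → Matrix ℝ n → Set
UniformlyPD A = ∃ λ c → 0ℚ < c × Eventually λ k → ∀ x → c * x · x ≤ Q (at A k) x

Kernel : ∀ {n} → Matrix ℝ n → Set
Kernel {n} A = ∃ λ (v : Vector ℝ n) → ¬ (∀ i → v i ≈ 0ℝ) × (∀ i → (A *ᵥ v) i ≈ 0ℝ)

-- A crude Cauchy-Schwarz inequality, uniform in the stage because Cauchy sequences are bounded.
-- Each induction step uses (β ξ + r)² ≤ 2 β² ξ² + 2 r², hence the doubled constants.
·-bound : ∀ {n} (b : Vector ℝ n) →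
          ∃ λ κ → 0ℚ ≤ κ × (∀ k x → atᵛ b k · x * atᵛ b k · x ≤ κ * x · x)
·-bound {zero}  b = 0ℚ , ℚ.≤-refl , λ _ _ → ℚ.≤-refl
·-bound {suc n} b with bounded (seq (b zero)) (cauchy (b zero)) | ·-bound (b ∘ suc)
... | B , 0<B , b≤B | κ , 0≤κ , h =
  (B * B + B * B) + (κ + κ) , 0≤+ (0≤+ (0≤² B) (0≤² B)) (0≤+ 0≤κ 0≤κ) , λ k x →
  let β = seq (b zero) k
      ξ = x zero
      r = atᵛ (b ∘ suc) k · tail x
      X = tail x · tail x
      0≤X : 0ℚ ≤ X
      0≤X = sum-nonneg (λ i → 0≤² (x (suc i)))
      u = B * B - β * β
      w = κ * X - r * r
  in ≤-by ((u + u) * (ξ * ξ) + (β * ξ - r) * (β * ξ - r) + (w + w) + (B * B + B * B) * X + (κ + κ) * (ξ * ξ))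
       (0≤+ (0≤+ (0≤+ (0≤+
         (0≤* (0≤+ (p≤q⇒0≤q-p (∣p∣≤B⇒p²≤B² (b≤B k))) (p≤q⇒0≤q-p (∣p∣≤B⇒p²≤B² (b≤B k)))) (0≤² ξ))
         (0≤² (β * ξ - r)))
         (0≤+ (p≤q⇒0≤q-p (h k (tail x))) (p≤q⇒0≤q-p (h k (tail x)))))
         (0≤* (0≤+ (0≤² B) (0≤² B)) 0≤X))
         (0≤* (0≤+ 0≤κ 0≤κ) (0≤² ξ)))
       (solve 6 (λ β ξ r X B κ →
         let u = B :* B :- β :* β
             w = κ :* X :- r :* r
         in (β :* ξ :+ r) :* (β :* ξ :+ r) :+
            ((u :+ u) :* (ξ :* ξ) :+ (β :* ξ :- r) :* (β :* ξ :- r) :+ (w :+ w)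
              :+ (B :* B :+ B :* B) :* X :+ (κ :+ κ) :* (ξ :* ξ))
            := ((B :* B :+ B :* B) :+ (κ :+ κ)) :* (ξ :* ξ :+ X))
         refl β ξ r X B κ)

uniformlyPD-lift : ∀ {n} (A : Matrix ℝ (suc n)) → Symmetricʳ A → BoundedBelow (A zero zero) →
                   UniformlyPD (schurʳ A) → UniformlyPD A
uniformlyPD-lift A A-sym (α , 0<α , a≥α) (c , 0<c , pd)
  with bounded (seq (A zero zero)) (cauchy (A zero zero)) | ·-bound (row A)
... | M , 0<M , a≤M | κ , 0≤κ , r²≤
  -- The new constant is δ = c α / D. After the pivot is cancelled, `definite-lift` reads c a (ξ² +
  -- X) ≤ D q, and α ≤ a.
  with scale {c + c + (κ + κ) + M * M} {c * α}
         (0<+ (0<+ (0<+ 0<c (ℚ.<⇒≤ 0<c)) (0≤+ 0≤κ 0≤κ)) (0≤² M)) (0<* 0<c 0<α)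
... | δ , 0<δ , Dδ≡cα = δ , 0<δ , eventually-map (λ {k} → lower k) (a≥α ⊗ pd)
  where
  D = c + c + (κ + κ) + M * M
  0<D : 0ℚ < D
  0<D = 0<+ (0<+ (0<+ 0<c (ℚ.<⇒≤ 0<c)) (0≤+ 0≤κ 0≤κ)) (0≤² M)
  lower : ∀ k → α ≤ at A k zero zero × (∀ x → c * x · x ≤ Q (schur (at A k)) x) →
          ∀ x → δ * x · x ≤ Q (at A k) x
  lower k (α≤a , pd) x = ℚ.*-cancelˡ-≤-pos D {{positive 0<D}} (begin
    D * (δ * (ξ * ξ + X))   ≡⟨ ℚ.*-assoc D δ (ξ * ξ + X) ⟨
    D * δ * (ξ * ξ + X)     ≡⟨ cong (_* (ξ * ξ + X)) Dδ≡cα ⟩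
    c * α * (ξ * ξ + X)     ≤⟨ ℚ.*-monoʳ-≤-nonNeg (ξ * ξ + X) {{nonNegative (0≤+ (0≤² ξ) 0≤X)}}
                                 (ℚ.*-monoˡ-≤-nonNeg c {{nonNegative (ℚ.<⇒≤ 0<c)}} α≤a) ⟩
    c * a * (ξ * ξ + X)     ≤⟨ ℚ.*-cancelˡ-≤-pos a {{positive 0<a}} (begin
      a * (c * a * (ξ * ξ + X))
        ≤⟨ definite-lift 0≤κ (ℚ.<⇒≤ 0<c) (ℚ.<⇒≤ 0<a) (ℚ.≤-trans (p≤∣p∣ a) (a≤M k)) 0≤X
             (r²≤ k (tail x)) (pd (tail x)) ⟩
      D * ((a * ξ + r) * (a * ξ + r) + Q (schur (at A k)) (tail x))
        ≡⟨ cong (D *_) (complete-square (at A k) (A-sym k) ξ (tail x)) ⟨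
      D * (a * q)
        ≡⟨ solve 3 (λ D a q → D :* (a :* q) := a :* (D :* q)) refl D a q ⟩
      a * (D * q) ∎) ⟩
    D * q                   ∎)
    where
    open ℚ.≤-Reasoning
    a = at A k zero zero
    ξ = x zero
    X = tail x · tail x
    r = row (at A k) · tail x
    q = Q (at A k) x
    0<a : 0ℚ < a
    0<a = ℚ.<-≤-trans 0<α α≤a
    0≤X : 0ℚ ≤ X
    0≤X = sum-nonneg (λ i → 0≤² (tail x i))

kernel-lift : ∀ {n} (A : Matrix ℝ (suc n)) → Symmetricʳ A → BoundedBelow (A zero zero) →
              Kernel (schurʳ A) → Kernel A
kernel-lift {n} A A-sym pos (y , y≉0 , Sy≈0) = v ,
  -- The lift is nonzero: the pivot is bounded away from 0, so a null product with it forces `y i`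
  -- to be null.
  (λ v≈0 → y≉0 λ i → cancel-null (A zero zero) (y i) pos (v≈0 (suc i))) , Av≈0
  where
  v : Vector ℝ (suc n)
  v zero    = fromℚ (- 1ℚ) *ʳ Σℝ (λ j → row A j *ʳ y j)
  v (suc i) = A zero zero *ʳ y i

  v≡lift : ∀ k i → atᵛ v k i ≡ schur-lift (at A k) (A-sym k) (atᵛ y k) i
  v≡lift k zero    = trans (cong (- 1ℚ *_) (seq-Σ (λ j → row A j *ʳ y j) k))
    (solve 1 (λ r → con (- 1ℚ) :* r := :- r) refl (row (at A k) · atᵛ y k))
  v≡lift k (suc i) = refl

  Av≡ : ∀ k i → seq ((A *ᵥ v) i) k ≡ (at A k ⊡ schur-lift (at A k) (A-sym k) (atᵛ y k)) i
  Av≡ k i = trans (seq-*ᵥ A v i k) (·-congʳ (at A k i) (v≡lift k))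

  Av≈0 : ∀ i → (A *ᵥ v) i ≈ 0ℝ
  Av≈0 zero    = ≈0-resp 0ℝ ((A *ᵥ v) zero)
    (λ k → sym (trans (Av≡ k zero) (proj₁ (⊡-schur-lift (at A k) (A-sym k) (atᵛ y k)))))
    (λ ε 0<ε → 0 , λ _ _ → 0<ε)
  Av≈0 (suc i) = ≈0-resp ((schurʳ A *ᵥ y) i) ((A *ᵥ v) (suc i))
    (λ k → trans (seq-*ᵥ (schurʳ A) y i k)
      (sym (trans (Av≡ k (suc i)) (proj₂ (⊡-schur-lift (at A k) (A-sym k) (atᵛ y k)) i))))
    (Sy≈0 i)

-- Let G bound the entry `minor A j j`, and put τ = G / ε, η = G / τ². Once the pivot is below η,
-- `psd-entry` at τ and - τ gives 2 τ |b| < η τ² + G = 2 G = 2 τ ε.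
row-null : ∀ {n} (A : Matrix ℝ (suc n)) → Symmetricʳ A → EventuallyPSD A →
           A zero zero ≈ 0ℝ → ∀ j → row A j ≈ 0ℝ
row-null A A-sym psd a≈0 j ε 0<ε
  with bounded (seq (minor A j j)) (cauchy (minor A j j))
... | G , 0<G , m≤G with scale 0<ε 0<G
... | τ , 0<τ , ετ≡G with scale (0<* 0<τ 0<τ) 0<G
... | η , 0<η , ττη≡G = eventually-map (λ {k} → small k) (psd ⊗ a≈0 η 0<η)
  where
  open ℚ.≤-Reasoning
  small : ∀ k → PSD (at A k) × ∣ at A k zero zero - 0ℚ ∣ < η → ∣ row (at A k) j - 0ℚ ∣ < ε
  small k (psd , a<η) = subst (λ p → ∣ p ∣ < ε) (sym (p-0≡p b)) (∣∣<-intro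
    (below b (psd-entry (at A k) (A-sym k) psd τ j))
    (below (- b) (subst₂ _≤_
      (solve 2 (λ τ b → (:- τ) :* b :+ (:- τ) :* b := τ :* (:- b) :+ τ :* (:- b)) refl τ b)
      (solve 3 (λ a τ m → a :* ((:- τ) :* (:- τ)) :+ m := a :* (τ :* τ) :+ m) refl a τ m)
      (psd-entry (at A k) (A-sym k) psd (- τ) j))))
    where
    a = at A k zero zero
    b = row (at A k) j
    m = minor (at A k) j j
    below : ∀ p → τ * p + τ * p ≤ a * (τ * τ) + m → p < ε
    below p h = ℚ.*-cancelˡ-<-nonNeg (τ + τ) {{nonNegative (0≤+ (ℚ.<⇒≤ 0<τ) (ℚ.<⇒≤ 0<τ))}} (begin-strict
      (τ + τ) * p          ≡⟨ ℚ.*-distribʳ-+ p τ τ ⟩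
      τ * p + τ * p        ≤⟨ h ⟩
      a * (τ * τ) + m      <⟨ ℚ.+-mono-<-≤
        (ℚ.*-monoˡ-<-pos (τ * τ) {{positive (0<* 0<τ 0<τ)}}
          (ℚ.≤-<-trans (p≤∣p∣ a) (subst (λ p → ∣ p ∣ < η) (p-0≡p a) a<η)))
        (ℚ.≤-trans (p≤∣p∣ m) (m≤G k)) ⟩
      η * (τ * τ) + G      ≡⟨ cong₂ _+_ (trans (ℚ.*-comm η (τ * τ)) (trans ττη≡G (sym ετ≡G))) (sym ετ≡G) ⟩
      ε * τ + ε * τ        ≡⟨ solve 2 (λ ε τ → ε :* τ :+ ε :* τ := (τ :+ τ) :* ε) refl ε τ ⟩
      (τ + τ) * ε          ∎)

kernel-e₀ : ∀ {n} (A : Matrix ℝ (suc n)) → Symmetricʳ A → A zero zero ≈ 0ℝ →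
            (∀ j → row A j ≈ 0ℝ) → Kernel A
kernel-e₀ {n} A A-sym a≈0 b≈0 = v , (λ v≈0 → 1≉0 (v≈0 zero)) , λ i → ≈0-resp (A zero i) ((A *ᵥ v) i) (column≡ i) (column≈0 i)
  where
  v : Vector ℝ (suc n)
  v i = fromℚ (e zero i)
  1≉0 : ¬ fromℚ 1ℚ ≈ 0ℝ
  1≉0 h = let N , p = h 1ℚ (ℚ.positive⁻¹ 1ℚ) in ℚ.<-irrefl refl (p N ℕ.≤-refl)
  column≡ : ∀ i k → seq (A zero i) k ≡ seq ((A *ᵥ v) i) k
  column≡ i k = trans (A-sym k zero i) (sym (trans (seq-*ᵥ A v i k) (·-e (at A k i) zero)))
  column≈0 : ∀ i → A zero i ≈ 0ℝ
  column≈0 zero    = a≈0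
  column≈0 (suc j) = b≈0 j

-- Induction under the assumption that there is no kernel. A pivot bounded away from 0 would hand
-- all assumptions on to the Schur complement, so the pivot is null. By semidefiniteness its row is
-- then null as well, and `e zero` spans a kernel after all.
¬uniformlyPD⇒¬¬kernel : ∀ {n} (A : Matrix ℝ n) → Symmetricʳ A → EventuallyPSD A →
                       ¬ UniformlyPD A → ¬ ¬ Kernel A
¬uniformlyPD⇒¬¬kernel {zero} A A-sym psd ¬pd ¬ker =
  ¬pd (1ℚ , ℚ.positive⁻¹ 1ℚ , 0 , λ _ _ _ → ℚ.≤-refl)
¬uniformlyPD⇒¬¬kernel {suc n} A A-sym psd ¬pd ¬ker =
  ¬ker (kernel-e₀ A A-sym a≈0 (row-null A A-sym psd a≈0))
  where
  ¬pos : ¬ BoundedBelow (A zero zero)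
  ¬pos pos@(α , 0<α , a≥α) = ¬uniformlyPD⇒¬¬kernel (schurʳ A)
    (λ k → schur-sym (at A k) (A-sym k))
    (eventually-map (λ {k} (α≤a , psd) → schur-psd (at A k) (A-sym k) (ℚ.<-≤-trans 0<α α≤a) psd) (a≥α ⊗ psd))
    (¬pd ∘ uniformlyPD-lift A A-sym pos)
    (¬ker ∘ kernel-lift A A-sym pos)
  a≈0 : A zero zero ≈ 0ℝ
  a≈0 = nonneg-null (A zero zero)
    (eventually-map (λ {k} psd → subst (0ℚ ≤_) (Q-e (at A k) zero) (psd (e zero))) psd) ¬pos

-- Embedding of ℕ and ℤ in ℚ

toℚᵘ-/ : ∀ i n .{{_ : NonZero n}} → toℚᵘ (i / n) ℚᵘ.≃ i ℚᵘ./ n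
toℚᵘ-/ i (suc n) = ℚ.toℚᵘ-fromℚᵘ (mkℚᵘ i n)

/1-+ : ∀ i j → (i ℤ.+ j) / 1 ≡ i / 1 + j / 1
/1-+ i j = ℚ.toℚᵘ-injective (begin
  toℚᵘ ((i ℤ.+ j) / 1)                ≈⟨ toℚᵘ-/ (i ℤ.+ j) 1 ⟩
  (i ℤ.+ j) ℚᵘ./ 1                    ≈⟨ *≡* (cong (ℤ._* ℤ.+ 1) (cong₂ ℤ._+_ (sym (ℤ.*-identityʳ i)) (sym (ℤ.*-identityʳ j)))) ⟩
  (i ℚᵘ./ 1) ℚᵘ.+ (j ℚᵘ./ 1)          ≈⟨ ℚᵘ.+-cong (toℚᵘ-/ i 1) (toℚᵘ-/ j 1) ⟨
  toℚᵘ (i / 1) ℚᵘ.+ toℚᵘ (j / 1)      ≈⟨ ℚ.toℚᵘ-homo-+ (i / 1) (j / 1) ⟨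
  toℚᵘ (i / 1 + j / 1)                ∎)
  where open ℚᵘ.≃-Reasoning

/1-neg : ∀ i → (ℤ.- i) / 1 ≡ - (i / 1)
/1-neg i = ℚ.toℚᵘ-injective (begin
  toℚᵘ ((ℤ.- i) / 1)  ≈⟨ toℚᵘ-/ (ℤ.- i) 1 ⟩
  ℚᵘ.- (i ℚᵘ./ 1)     ≈⟨ ℚᵘ.-‿cong (toℚᵘ-/ i 1) ⟨
  ℚᵘ.- toℚᵘ (i / 1)   ≈⟨ ℚ.toℚᵘ-homo‿- (i / 1) ⟨
  toℚᵘ (- (i / 1))    ∎)
  where open ℚᵘ.≃-Reasoning

ι : ℕ → ℚ
ι n = ℤ.+ n / 1

ι-+ : ∀ m n → ι (m ℕ.+ n) ≡ ι m + ι n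
ι-+ m n = /1-+ (ℤ.+ m) (ℤ.+ n)

ι-suc : ∀ n → ι (suc n) ≡ 1ℚ + ι n
ι-suc n = ι-+ 1 n

ι-* : ∀ m n → ι (m ℕ.* n) ≡ ι m * ι n
ι-* zero    n = sym (ℚ.*-zeroˡ (ι n))
ι-* (suc m) n = begin
  ι (n ℕ.+ m ℕ.* n)   ≡⟨ ι-+ n (m ℕ.* n) ⟩
  ι n + ι (m ℕ.* n)   ≡⟨ cong (_+_ (ι n)) (ι-* m n) ⟩
  ι n + ι m * ι n     ≡⟨ solve 2 (λ m n → n :+ m :* n := (con 1ℚ :+ m) :* n) refl (ι m) (ι n) ⟩
  (1ℚ + ι m) * ι n    ≡⟨ cong (_* ι n) (ι-suc m) ⟨
  ι (suc m) * ι n     ∎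
  where open ≡-Reasoning

ι-mono-≤ : ∀ {m n} → m ℕ.≤ n → ι m ≤ ι n
ι-mono-≤ {m} {n} m≤n = ℚ.toℚᵘ-cancel-≤
  (ℚᵘ.≤-respˡ-≃ (ℚᵘ.≃-sym (toℚᵘ-/ (ℤ.+ m) 1)) (ℚᵘ.≤-respʳ-≃ (ℚᵘ.≃-sym (toℚᵘ-/ (ℤ.+ n) 1))
    (*≤* (ℤ.*-monoʳ-≤-nonNeg (ℤ.+ 1) (+≤+ m≤n)))))

ι-cancel-≤ : ∀ {m n} → ι m ≤ ι n → m ℕ.≤ n
ι-cancel-≤ {m} {n} ιm≤ιn = ℕ.≮⇒≥ λ n<m → ℚ.<-irrefl refl (begin-strict
  ι n        <⟨ <-by 1ℚ (ℚ.positive⁻¹ 1ℚ) (ℚ.+-comm (ι n) 1ℚ) ⟩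
  1ℚ + ι n   ≡⟨ ι-suc n ⟨
  ι (suc n)  ≤⟨ ι-mono-≤ n<m ⟩
  ι m        ≤⟨ ιm≤ιn ⟩
  ι n        ∎)
  where open ℚ.≤-Reasoning

ι-injective : ∀ {m n} → ι m ≡ ι n → m ≡ n
ι-injective eq =
  ℕ.≤-antisym (ι-cancel-≤ (ℚ.≤-reflexive eq)) (ι-cancel-≤ (ℚ.≤-reflexive (sym eq)))

0≤ι : ∀ n → 0ℚ ≤ ι n
0≤ι n = ι-mono-≤ (ℕ.z≤n {n})

0<ι : ∀ n .{{_ : NonZero n}} → 0ℚ < ι n
0<ι (suc n) = subst (0ℚ <_) (sym (ι-suc n)) (0<+ (ℚ.positive⁻¹ 1ℚ) (0≤ι n))

ι-*-/ : ∀ m n .{{_ : NonZero n}} → ι n * (ℤ.+ m / n) ≡ ι m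
ι-*-/ m n@(suc _) = ℚ.toℚᵘ-injective (begin
  toℚᵘ (ι n * (ℤ.+ m / n))               ≈⟨ ℚ.toℚᵘ-homo-* (ι n) (ℤ.+ m / n) ⟩
  toℚᵘ (ι n) ℚᵘ.* toℚᵘ (ℤ.+ m / n)       ≈⟨ ℚᵘ.*-cong (toℚᵘ-/ (ℤ.+ n) 1) (toℚᵘ-/ (ℤ.+ m) n) ⟩
  (ℤ.+ n ℚᵘ./ 1) ℚᵘ.* (ℤ.+ m ℚᵘ./ n)       ≈⟨ *≡* (trans (ℤ.*-identityʳ (ℤ.+ n ℤ.* ℤ.+ m))
                                            (trans (ℤ.*-comm (ℤ.+ n) (ℤ.+ m))
                                              (cong (λ d → ℤ.+ m ℤ.* ℤ.+ d) (sym (ℕ.*-identityˡ n))))) ⟩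
  ℤ.+ m ℚᵘ./ 1                           ≈⟨ toℚᵘ-/ (ℤ.+ m) 1 ⟨
  toℚᵘ (ι m)                           ∎)
  where open ℚᵘ.≃-Reasoning

1/1+ : ℕ → ℚ
1/1+ k = ℤ.+ 1 / suc k

-- A positive ε is at least 1 over its own denominator q + 1, so every k > q will do.
archimedean : ∀ {ε} → 0ℚ < ε → Eventually λ k → 1/1+ k < ε
archimedean {ε@(mkℚ (ℤ.+ suc p) q _)} 0<ε = suc q , λ k q<k →
  ℚ.toℚᵘ-cancel-< (ℚᵘ.<-respˡ-≃ (ℚᵘ.≃-sym (toℚᵘ-/ (ℤ.+ 1) (suc k)))
    (*<* (ℤ.+<+ (ℕ.s≤s (subst (ℕ._≤ k ℕ.+ p ℕ.* suc k) (sym (ℕ.+-identityʳ (suc q)))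
       (ℕ.≤-trans q<k (ℕ.m≤m+n k _)))))))
archimedean {mkℚ (ℤ.+ zero) _ _}    (*<* (ℤ.+<+ ()))
archimedean {mkℚ (ℤ.-[1+ _ ]) _ _} (*<* ())

-- The largest eigenvalue of a rational symmetric matrix

e-sym : ∀ {n} (i j : Fin n) → e i j ≡ e j i
e-sym zero    zero    = refl
e-sym zero    (suc j) = refl
e-sym (suc i) zero    = refl
e-sym (suc i) (suc j) = e-sym i j

infix 4 _≼_
-- The Löwner bound L ≤ t I: all Rayleigh quotients are at most t, stated without dividing by x · x.
_≼_ : ∀ {n} → Matrix ℚ n → ℚ → Set
L ≼ t = ∀ x → Q L x ≤ t * x · x

0≤x·x : ∀ {n} (x : Vector ℚ n) → 0ℚ ≤ x · x
0≤x·x x = sum-nonneg λ i → 0≤² (x i)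

≼-mono : ∀ {n} (L : Matrix ℚ n) s t → s ≤ t → L ≼ s → L ≼ t
≼-mono L s t s≤t L≼s x = ℚ.≤-trans (L≼s x) (ℚ.*-monoʳ-≤-nonNeg (x · x) {{nonNegative (0≤x·x x)}} s≤t)

shift : ∀ {n} → Matrix ℚ n → ℚ → Matrix ℚ n
shift L t i j = t * e i j + - L i j

shift-sym : ∀ {n} (L : Matrix ℚ n) t → Symmetric L → Symmetric (shift L t)
shift-sym L t L-sym i j = cong₂ (λ p q → t * p + - q) (e-sym i j) (L-sym i j)

⊡-shift : ∀ {n} (L : Matrix ℚ n) t x i → (shift L t ⊡ x) i ≡ t * x i + - 1ℚ * (L ⊡ x) i
⊡-shift L t x i = begin
  shift L t i · x
    ≡⟨ ·-comm (shift L t i) x ⟩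
  x · shift L t i
    ≡⟨ ·-congʳ x (λ j → cong (t * e i j +_)
         (solve 1 (λ l → :- l := con (- 1ℚ) :* l) refl (L i j))) ⟩
  x · (λ j → t * e i j + - 1ℚ * L i j)
    ≡⟨ ·-linearʳ x (e i) (L i) t (- 1ℚ) ⟩
  t * x · e i + - 1ℚ * x · L i
    ≡⟨ cong₂ (λ p q → t * p + - 1ℚ * q) (·-e x i) (·-comm x (L i)) ⟩
  t * x i + - 1ℚ * (L ⊡ x) i
    ∎
  where open ≡-Reasoning

Q-shift : ∀ {n} (L : Matrix ℚ n) t x → Q (shift L t) x ≡ t * x · x - Q L x
Q-shift L t x = trans (·-congʳ x (⊡-shift L t x))
  (trans (·-linearʳ x x (L ⊡ x) t (- 1ℚ))
    (solve 3 (λ t s q → t :* s :+ con (- 1ℚ) :* q := t :* s :- q) refl t (x · x) (Q L x)))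

psd⇒≼ : ∀ {n} (L : Matrix ℚ n) t → PSD (shift L t) → L ≼ t
psd⇒≼ L t psd x = ≤-by (Q (shift L t) x) (psd x)
  (trans (cong (Q L x +_) (Q-shift L t x))
    (solve 2 (λ q s → q :+ (s :- q) := s) refl (Q L x) (t * x · x)))

≼⇒psd : ∀ {n} (L : Matrix ℚ n) t → L ≼ t → PSD (shift L t)
≼⇒psd L t L≼t x = subst (0ℚ ≤_) (sym (Q-shift L t x)) (p≤q⇒0≤q-p (L≼t x))

≼? : ∀ {n} (L : Matrix ℚ n) → Symmetric L → ∀ t → ¬ (L ≼ t) ⊎ L ≼ t
≼? L L-sym t with psd? (shift L t) (shift-sym L t L-sym)
... | inj₂ psd       = inj₂ (psd⇒≼ L t psd)
... | inj₁ (x , q<0) = inj₁ λ L≼t → ℚ.<-irrefl refl (ℚ.<-≤-trans q<0 (≼⇒psd L t L≼t x))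

fromℚᴹ : ∀ {n} → Matrix ℚ n → Matrix ℝ n
fromℚᴹ L i j = fromℚ (L i j)

-- The largest eigenvalue is the infimum of the t for which t I - L is positive
-- semidefinite; stage k approximates it from above on the grid of mesh g k.
module TopEigenvalue {n} (L : Matrix ℚ n) (L-sym : Symmetric L) {T : ℚ} (0<T : 0ℚ < T)
  (L≼T : L ≼ T) (L⋠0 : ¬ (L ≼ 0ℚ)) where

  g : ℕ → ℚ
  g k = T * 1/1+ k

  g-small : ∀ {ε} → 0ℚ < ε → Eventually λ k → g k < ε
  g-small 0<ε with scale 0<T 0<ε
  ... | δ , 0<δ , refl = eventually-map (ℚ.*-monoʳ-<-pos T {{positive 0<T}}) (archimedean 0<δ)

  -- Descends the multiples of p from a valid bound to the first failure, which `L⋠0` guarantees at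
  -- 0 at the latest.
  first : ∀ p j → L ≼ (ι j * p) → ∃ λ t → ¬ (L ≼ t) × L ≼ (p + t)
  first p zero    L≼0 = contradiction (subst (L ≼_) (ℚ.*-zeroˡ p) L≼0) L⋠0
  first p (suc j) L≼t with ≼? L L-sym (ι j * p)
  ... | inj₂ L≼s = first p j L≼s
  ... | inj₁ L⋠s = ι j * p , L⋠s , subst (L ≼_) (begin
    ι (suc j) * p   ≡⟨ cong (_* p) (ι-suc j) ⟩
    (1ℚ + ι j) * p  ≡⟨ solve 2 (λ i p → (con 1ℚ :+ i) :* p := p :+ i :* p) refl (ι j) p ⟩
    p + ι j * p     ∎) L≼t
    where open ≡-Reasoning

  top≡T : ∀ k → ι (suc k) * g k ≡ T
  top≡T k = begin
    ι (suc k) * (T * 1/1+ k)  ≡⟨ solve 3 (λ i t h → i :* (t :* h) := t :* (i :* h)) refl (ι (suc k)) T (1/1+ k) ⟩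
    T * (ι (suc k) * 1/1+ k)  ≡⟨ cong (T *_) (ι-*-/ 1 (suc k)) ⟩
    T * 1ℚ                 ≡⟨ ℚ.*-identityʳ T ⟩
    T                      ∎
    where open ≡-Reasoning

  -- Only the two bounds matter from here on, so the search itself is sealed.
  abstract
    grid : ∀ k → ∃ λ t → ¬ (L ≼ t) × L ≼ (g k + t)
    grid k = first (g k) (suc k) (subst (L ≼_) (sym (top≡T k)) L≼T)

  lower upper : ℕ → ℚ
  lower k = proj₁ (grid k)
  upper k = g k + lower k

  L⋠lower : ∀ k → ¬ (L ≼ lower k)
  L⋠lower k = proj₁ (proj₂ (grid k))

  L≼upper : ∀ k → L ≼ upper k
  L≼upper k = proj₂ (proj₂ (grid k))

  -- Valid bounds are upward closed, so a failing `lower k` lies below every valid `upper m`,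
  -- whichever of k and m is larger. With the shrinking mesh this gives the Cauchy property.
  upper-near : ∀ k m → upper k - upper m < g k
  upper-near k m = <-by (upper m - lower k)
    (p<q⇒0<q-p (ℚ.≰⇒> λ m≤k → L⋠lower k (≼-mono L (upper m) (lower k) m≤k (L≼upper m))))
    (solve 3 (λ g l u → g :+ l :- u :+ (u :- l) := g) refl (g k) (lower k) (upper m))

  upper-cauchy : Cauchy upper
  upper-cauchy ε 0<ε = proj₁ (g-small 0<ε) , λ k m N≤k N≤m → ∣∣<-intro
    (ℚ.<-trans (upper-near k m) (g<ε k N≤k))
    (subst (_< ε) (solve 2 (λ a b → a :- b := :- (b :- a)) refl (upper m) (upper k))
      (ℚ.<-trans (upper-near m k) (g<ε m N≤m)))
    where
    g<ε = proj₂ (g-small 0<ε)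

  μ : ℝ
  μ = real upper upper-cauchy

  private
    A : Matrix ℝ n
    -- This is μ I - L; its stage k is `shift L (upper k)`.
    A i j = μ *ʳ fromℚ (e i j) +ʳ fromℚ (- L i j)

    -- Once the mesh g N is below c, the definiteness constant pays for the step from `upper N` down
    -- to `lower N`, where the bound is known to fail.
    ¬uniformlyPD : ¬ UniformlyPD A
    ¬uniformlyPD (c , 0<c , pd) with pd ⊗ g-small 0<c
    ... | N , both with both N ℕ.≤-refl
    ... | pd , g<c = L⋠lower N λ x → ≤-by
      ((Q (shift L (upper N)) x - c * x · x) + (c - g N) * x · x)
      (0≤+ (p≤q⇒0≤q-p (pd x)) (0≤* (p≤q⇒0≤q-p (ℚ.<⇒≤ g<c)) (0≤x·x x)))
      (trans (cong (λ q → Q L x + ((q - c * x · x) + (c - g N) * x · x))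
               (Q-shift L (upper N) x))
        (solve 5 (λ q g l c s → q :+ ((((g :+ l) :* s :- q) :- c :* s) :+ (c :- g) :* s) := l :* s)
          refl (Q L x) (g N) (lower N) c (x · x)))

    eigenvalue : Kernel A → IsEigenvalue (fromℚᴹ L) μ
    eigenvalue (v , v≉0 , Av≈0) = v , v≉0 , λ i ε 0<ε →
      eventually-map (λ {k} → subst (_< ε) (∣Av∣≡ i k)) (Av≈0 i ε 0<ε)
      where
      ∣Av∣≡ : ∀ i k → ∣ seq ((A *ᵥ v) i) k - 0ℚ ∣ ≡ ∣ seq ((fromℚᴹ L *ᵥ v) i) k - upper k * seq (v i) k ∣
      ∣Av∣≡ i k = begin
        ∣ seq ((A *ᵥ v) i) k - 0ℚ ∣
          ≡⟨ cong (λ p → ∣ p - 0ℚ ∣) (trans (seq-*ᵥ A v i k) (⊡-shift L (upper k) (atᵛ v k) i)) ⟩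
        ∣ upper k * seq (v i) k + - 1ℚ * l - 0ℚ ∣
          ≡⟨ cong ∣_∣ (solve 2 (λ u l → u :+ con (- 1ℚ) :* l :- con 0ℚ := :- (l :- u)) refl (upper k * seq (v i) k) l) ⟩
        ∣ - (l - upper k * seq (v i) k) ∣
          ≡⟨ ℚ.∣-p∣≡∣p∣ (l - upper k * seq (v i) k) ⟩
        ∣ l - upper k * seq (v i) k ∣
          ≡⟨ cong (λ l → ∣ l - upper k * seq (v i) k ∣) (seq-*ᵥ (fromℚᴹ L) v i k) ⟨
        ∣ seq ((fromℚᴹ L *ᵥ v) i) k - upper k * seq (v i) k ∣
          ∎
        where
        open ≡-Reasoning
        l = (L ⊡ atᵛ v k) i

  ¬¬eigenvalue : ¬ ¬ IsEigenvalue (fromℚᴹ L) μ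
  ¬¬eigenvalue ¬eig = ¬uniformlyPD⇒¬¬kernel A (λ k → shift-sym L (upper k) L-sym)
    (0 , λ k _ → ≼⇒psd L (upper k) (L≼upper k)) ¬uniformlyPD (¬eig ∘ eigenvalue)

-- Null reals, and rational upper bounds for real eigenvalues

+-null : ∀ x y → x ≈ 0ℝ → y ≈ 0ℝ → x +ʳ y ≈ 0ℝ
+-null x y x≈0 y≈0 ε 0<ε =
  eventually-map (λ {k} (x< , y<) → small k x< y<) (x≈0 (½ * ε) (half-pos 0<ε) ⊗ y≈0 (½ * ε) (half-pos 0<ε))
  where
  open ℚ.≤-Reasoning
  small : ∀ k → ∣ seq x k - 0ℚ ∣ < ½ * ε → ∣ seq y k - 0ℚ ∣ < ½ * ε → ∣ seq x k + seq y k - 0ℚ ∣ < ε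
  small k x< y< = begin-strict
    ∣ seq x k + seq y k - 0ℚ ∣
      ≡⟨ cong ∣_∣ (solve 2 (λ x y → x :+ y :- con 0ℚ := (x :- con 0ℚ) :+ (y :- con 0ℚ)) refl (seq x k) (seq y k)) ⟩
    ∣ (seq x k - 0ℚ) + (seq y k - 0ℚ) ∣      ≤⟨ ℚ.∣p+q∣≤∣p∣+∣q∣ (seq x k - 0ℚ) (seq y k - 0ℚ) ⟩
    ∣ seq x k - 0ℚ ∣ + ∣ seq y k - 0ℚ ∣      <⟨ ℚ.+-mono-< x< y< ⟩
    ½ * ε + ½ * ε                            ≡⟨ halves ε ⟩
    ε                                        ∎

*-null : ∀ x y → y ≈ 0ℝ → x *ʳ y ≈ 0ℝ
*-null x y y≈0 ε 0<ε with bounded (seq x) (cauchy x)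
... | B , 0<B , x≤B with scale 0<B 0<ε
... | δ , 0<δ , refl = eventually-map (λ {k} y<δ →
  subst (λ p → ∣ p ∣ < B * δ) (sym (p-0≡p (seq x k * seq y k)))
    (∣*∣-< (seq x k) (seq y k) 0<B (x≤B k) (subst (λ p → ∣ p ∣ < δ) (p-0≡p (seq y k)) y<δ)))
  (y≈0 δ 0<δ)

Σ-null : ∀ {n} (f : Vector ℝ n) → (∀ i → f i ≈ 0ℝ) → Σℝ f ≈ 0ℝ
Σ-null {zero}  f f≈0 ε 0<ε = 0 , λ _ _ → 0<ε
Σ-null {suc n} f f≈0 = +-null (f zero) (Σℝ (f ∘ suc)) (f≈0 zero) (Σ-null (f ∘ suc) (f≈0 ∘ suc))

entry≤∑ : ∀ {n} (f : Vector ℚ n) → (∀ i → 0ℚ ≤ f i) → ∀ i → f i ≤ ∑ f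
entry≤∑ f 0≤f zero    = ≤-by (∑ (f ∘ suc)) (sum-nonneg (0≤f ∘ suc)) refl
entry≤∑ f 0≤f (suc i) = ℚ.≤-trans (entry≤∑ (f ∘ suc) (0≤f ∘ suc) i)
  (≤-by (f zero) (0≤f zero) (ℚ.+-comm (∑ (f ∘ suc)) (f zero)))

infix 4 _⋘_
-- Strict order with a rational gap, on bare sequences so that a constant bound needs no Cauchy
-- proof.
_⋘_ : (ℕ → ℚ) → (ℕ → ℚ) → Set
f ⋘ g = ∃ λ δ → 0ℚ < δ × Eventually λ k → f k + δ ≤ g k

-- The vector w = ρ v - L v is null, hence so is v · w. But the gap gives v · w ≥ δ (v · v) at late
-- stages, so every entry of v is null.
no-eigenvalue-above : ∀ {n} (L : Matrix ℚ n) B → L ≼ B → ∀ ρ → (λ _ → B) ⋘ seq ρ →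
                      ¬ IsEigenvalue (fromℚᴹ L) ρ
no-eigenvalue-above {n} L B L≼B ρ (δ , 0<δ , ρ≥) (v , v≉0 , Lv≈ρv) = v≉0 v≈0
  where
  w : Vector ℝ n
  w i = ρ *ʳ v i +ʳ fromℚ (- 1ℚ) *ʳ (fromℚᴹ L *ᵥ v) i

  w≈0 : ∀ i → w i ≈ 0ℝ
  w≈0 i ε 0<ε = eventually-map (λ {k} → subst (_< ε) (eq k)) (Lv≈ρv i ε 0<ε)
    where
    eq : ∀ k → ∣ seq ((fromℚᴹ L *ᵥ v) i) k - seq ρ k * seq (v i) k ∣ ≡ ∣ seq (w i) k - 0ℚ ∣
    eq k = trans (sym (ℚ.∣-p∣≡∣p∣ _)) (cong ∣_∣
      (solve 2 (λ l u → :- (l :- u) := u :+ con (- 1ℚ) :* l :- con 0ℚ) refl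
        (seq ((fromℚᴹ L *ᵥ v) i) k) (seq ρ k * seq (v i) k)))

  s : ℝ
  s = Σℝ λ i → v i *ʳ w i

  s≈0 : s ≈ 0ℝ
  s≈0 = Σ-null _ λ i → *-null (v i) (w i) (w≈0 i)

  seq-s : ∀ k → seq s k ≡ seq ρ k * atᵛ v k · atᵛ v k + - 1ℚ * Q L (atᵛ v k)
  seq-s k = trans (seq-Σ (λ i → v i *ʳ w i) k)
    (trans (·-congʳ (atᵛ v k) (λ i → cong (λ l → seq ρ k * seq (v i) k + - 1ℚ * l) (seq-*ᵥ (fromℚᴹ L) v i k)))
      (·-linearʳ (atᵛ v k) (atᵛ v k) (L ⊡ atᵛ v k) (seq ρ k) (- 1ℚ)))

  v≈0 : ∀ i → v i ≈ 0ℝ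
  -- If the entry reached ε in absolute value, v · w would be at least δ ε².
  v≈0 i ε 0<ε = eventually-map (λ {k} (ρ≥ , s<) → small k ρ≥ s<) (ρ≥ ⊗ s≈0 (δ * (ε * ε)) (0<* 0<δ (0<* 0<ε 0<ε)))
    where
    open ℚ.≤-Reasoning
    small : ∀ k → B + δ ≤ seq ρ k → ∣ seq s k - 0ℚ ∣ < δ * (ε * ε) → ∣ seq (v i) k - 0ℚ ∣ < ε
    small k B+δ≤ρ s< = subst (λ p → ∣ p ∣ < ε) (sym (p-0≡p p)) (ℚ.≰⇒> λ ε≤∣p∣ →
      ℚ.<-irrefl refl (begin-strict
        δ * (ε * ε)      ≤⟨ ℚ.*-monoˡ-≤-nonNeg δ {{nonNegative (ℚ.<⇒≤ 0<δ)}} (ε²≤p² ε≤∣p∣) ⟩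
        δ * (p * p)      ≤⟨ ℚ.*-monoˡ-≤-nonNeg δ {{nonNegative (ℚ.<⇒≤ 0<δ)}} (entry≤∑ _ (λ j → 0≤² (x j)) i) ⟩
        δ * x · x        ≤⟨ ≤-by ((seq ρ k - (B + δ)) * x · x + (B * x · x - Q L x))
                             (0≤+ (0≤* (p≤q⇒0≤q-p B+δ≤ρ) (0≤x·x x)) (p≤q⇒0≤q-p (L≼B x)))
                             (solve 5 (λ δ ρ B s q → δ :* s :+ ((ρ :- (B :+ δ)) :* s :+ (B :* s :- q)) := ρ :* s :+ con (- 1ℚ) :* q)
                               refl δ (seq ρ k) B (x · x) (Q L x)) ⟩
        seq ρ k * x · x + - 1ℚ * Q L x   ≡⟨ seq-s k ⟨
        seq s k          ≤⟨ p≤∣p∣ (seq s k) ⟩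
        ∣ seq s k ∣      ≡⟨ cong ∣_∣ (p-0≡p (seq s k)) ⟨
        ∣ seq s k - 0ℚ ∣ <⟨ s< ⟩
        δ * (ε * ε)      ∎))
      where
      x = atᵛ v k
      p = seq (v i) k
      ε²≤p² : ε ≤ ∣ p ∣ → ε * ε ≤ p * p
      ε²≤p² ε≤ = subst (ε * ε ≤_) (∣p∣²≡p² p) (∣p∣≤B⇒p²≤B² (subst (_≤ ∣ p ∣) (sym (ℚ.0≤p⇒∣p∣≡p (ℚ.<⇒≤ 0<ε))) ε≤))

-- The order of the reals through rational gaps

gap-persists : ∀ ε xₖ xₘ yₖ yₘ → yₖ + ε ≤ xₖ → xₖ - xₘ ≤ ½ * (½ * ε) → yₘ - yₖ ≤ ½ * (½ * ε) →
               yₘ + ½ * ε ≤ xₘ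
gap-persists ε xₖ xₘ yₖ yₘ gap x-close y-close = ≤-by
  ((½ * (½ * ε) - (xₖ - xₘ)) + (½ * (½ * ε) - (yₘ - yₖ)) + (xₖ - (yₖ + ε)))
  (0≤+ (0≤+ (p≤q⇒0≤q-p x-close) (p≤q⇒0≤q-p y-close)) (p≤q⇒0≤q-p gap))
  (solve 5 (λ ε xₖ xₘ yₖ yₘ → let q = con ½ :* (con ½ :* ε) in
    yₘ :+ con ½ :* ε :+ ((q :- (xₖ :- xₘ)) :+ (q :- (yₘ :- yₖ)) :+ (xₖ :- (yₖ :+ ε))) := xₘ)
    refl ε xₖ xₘ yₖ yₘ)

-- A gap of ε at one late index survives as ε/2 at all late indices, because x and y each move by at
-- most ε/4. Hence a single failure of the bound already refutes the hypothesis.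
≤ʳ-intro : ∀ x y → ¬ (seq y ⋘ seq x) → x ≤ʳ y
≤ʳ-intro x y ¬above ε 0<ε = N , λ k N≤k → ℚ.≰⇒> λ gap → ¬above
  (½ * ε , half-pos 0<ε , N , λ m N≤m → gap-persists ε (seq x k) (seq x m) (seq y k) (seq y m) gap
    (near x (proj₂ cx) k m (x-near k N≤k) (x-near m N≤m))
    (near y (proj₂ cy) m k (y-near m N≤m) (y-near k N≤k)))
  where
  δ = ½ * (½ * ε)
  cx = cauchy x δ (half-pos (half-pos 0<ε))
  cy = cauchy y δ (half-pos (half-pos 0<ε))
  N = proj₁ cx ℕ.⊔ proj₁ cy
  x-near : ∀ k → N ℕ.≤ k → proj₁ cx ℕ.≤ k
  x-near k = ℕ.m⊔n≤o⇒m≤o (proj₁ cx) (proj₁ cy)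
  y-near : ∀ k → N ℕ.≤ k → proj₁ cy ℕ.≤ k
  y-near k = ℕ.m⊔n≤o⇒n≤o (proj₁ cx) (proj₁ cy)
  near : ∀ z {M} → (∀ k m → M ℕ.≤ k → M ℕ.≤ m → ∣ seq z k - seq z m ∣ < δ) →
         ∀ k m → M ℕ.≤ k → M ℕ.≤ m → seq z k - seq z m ≤ δ
  near z close k m M≤k M≤m = ℚ.≤-trans (p≤∣p∣ (seq z k - seq z m)) (ℚ.<⇒≤ (close k m M≤k M≤m))

⋘-trans : ∀ B μ σ ρ → (∀ k → B ≤ seq μ k) → μ ≤ʳ σ → seq σ ⋘ seq ρ → (λ _ → B) ⋘ seq ρ
⋘-trans B μ σ ρ B≤μ μ≤σ (δ , 0<δ , σ+δ≤ρ) =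
  ½ * δ , half-pos 0<δ ,
  eventually-map (λ {k} (σ+δ≤ρ , μ<σ+δ/2) → bound k σ+δ≤ρ μ<σ+δ/2) (σ+δ≤ρ ⊗ μ≤σ (½ * δ) (half-pos 0<δ))
  where
  open ℚ.≤-Reasoning
  bound : ∀ k → seq σ k + δ ≤ seq ρ k → seq μ k < seq σ k + ½ * δ → B + ½ * δ ≤ seq ρ k
  bound k σ+δ≤ρ μ<σ+δ/2 = begin
    B + ½ * δ                    ≤⟨ ℚ.+-monoˡ-≤ (½ * δ) (B≤μ k) ⟩
    seq μ k + ½ * δ              ≤⟨ ℚ.+-monoˡ-≤ (½ * δ) (ℚ.<⇒≤ μ<σ+δ/2) ⟩
    seq σ k + ½ * δ + ½ * δ      ≡⟨ trans (ℚ.+-assoc (seq σ k) (½ * δ) (½ * δ)) (cong (seq σ k +_) (halves δ)) ⟩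
    seq σ k + δ                  ≤⟨ σ+δ≤ρ ⟩
    seq ρ k                      ∎

e-diag : ∀ {n} (i : Fin n) → e i i ≡ 1ℚ
e-diag zero    = refl
e-diag (suc i) = e-diag i

e-off : ∀ {n} {i j : Fin n} → i ≢ j → e i j ≡ 0ℚ
e-off {i = zero}  {zero}  i≢j = contradiction refl i≢j
e-off {i = zero}  {suc j} i≢j = refl
e-off {i = suc i} {zero}  i≢j = refl
e-off {i = suc i} {suc j} i≢j = e-off (i≢j ∘ cong suc)

-- Graph Laplacians

𝟙 : Bool → ℚ
𝟙 b = if b then 1ℚ else 0ℚ

0≤𝟙 : ∀ b → 0ℚ ≤ 𝟙 b
0≤𝟙 true  = ℚ.<⇒≤ (ℚ.positive⁻¹ 1ℚ)
0≤𝟙 false = ℚ.≤-refl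

adjℚ : ∀ {n} → Graph n → Matrix ℚ n
adjℚ G i j = 𝟙 (adj G i j)

adjℚ-sym : ∀ {n} (G : Graph n) → Symmetric (adjℚ G)
adjℚ-sym G i j = cong 𝟙 (adj-sym G i j)

adjℚ-diag : ∀ {n} (G : Graph n) i → adjℚ G i i ≡ 0ℚ
adjℚ-diag G i = cong 𝟙 (no-loop G i)

deg : ∀ {n} → Graph n → Vector ℚ n
deg G i = ∑ (adjℚ G i)

0≤deg : ∀ {n} (G : Graph n) i → 0ℚ ≤ deg G i
0≤deg G i = sum-nonneg λ j → 0≤𝟙 (adj G i j)

ι-∣tabulate∣ : ∀ {n} (f : Fin n → Bool) → ι ∣ Vec.tabulate f ∣ˢ ≡ ∑ (𝟙 ∘ f)
ι-∣tabulate∣ {zero}  f = refl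
ι-∣tabulate∣ {suc n} f with f zero
... | true  = trans (ι-suc ∣ Vec.tabulate (f ∘ suc) ∣ˢ) (cong (1ℚ +_) (ι-∣tabulate∣ (f ∘ suc)))
... | false = trans (ι-∣tabulate∣ (f ∘ suc)) (sym (ℚ.+-identityˡ (∑ (𝟙 ∘ f ∘ suc))))

ι-degree : ∀ {n} (G : Graph n) i → ι (degree G i) ≡ deg G i
ι-degree G i = ι-∣tabulate∣ (adj G i)

lapℚ : ∀ {n} → Graph n → Matrix ℚ n
lapℚ G i j = laplacian G i j / 1

lapℚ≡ : ∀ {n} (G : Graph n) i j → lapℚ G i j ≡ deg G i * e i j + - 1ℚ * adjℚ G i j
lapℚ≡ G i j = begin
  (degreeMatrix G i j ℤ.- adjacencyMatrix G i j) / 1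
    ≡⟨ /1-+ (degreeMatrix G i j) (ℤ.- adjacencyMatrix G i j) ⟩
  degreeMatrix G i j / 1 + (ℤ.- adjacencyMatrix G i j) / 1
    ≡⟨ cong₂ _+_ diagonal (trans (/1-neg (adjacencyMatrix G i j)) (trans (cong -_ off-diagonal)
         (solve 1 (λ a → :- a := con (- 1ℚ) :* a) refl (adjℚ G i j)))) ⟩
  deg G i * e i j + - 1ℚ * adjℚ G i j
    ∎
  where
  open ≡-Reasoning
  diagonal : degreeMatrix G i j / 1 ≡ deg G i * e i j
  diagonal with i ≟ᶠ j
  ... | yes refl = trans (ι-degree G i) (sym (trans (cong (deg G i *_) (e-diag i)) (ℚ.*-identityʳ (deg G i))))
  ... | no  i≢j  = sym (trans (cong (deg G i *_) (e-off i≢j)) (ℚ.*-zeroʳ (deg G i)))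
  off-diagonal : adjacencyMatrix G i j / 1 ≡ adjℚ G i j
  off-diagonal with adj G i j
  ... | true  = refl
  ... | false = refl

lapℚ-sym : ∀ {n} (G : Graph n) → Symmetric (lapℚ G)
lapℚ-sym G i j = trans (lapℚ≡ G i j) (trans (cong₂ (λ p q → p + - 1ℚ * q) diagonal (adjℚ-sym G i j)) (sym (lapℚ≡ G j i)))
  where
  diagonal : deg G i * e i j ≡ deg G j * e j i
  diagonal with i ≟ᶠ j
  ... | yes refl = refl
  ... | no  i≢j  = begin
    deg G i * e i j  ≡⟨ cong (deg G i *_) (e-off i≢j) ⟩
    deg G i * 0ℚ     ≡⟨ ℚ.*-zeroʳ (deg G i) ⟩
    0ℚ               ≡⟨ ℚ.*-zeroʳ (deg G j) ⟨
    deg G j * 0ℚ     ≡⟨ cong (deg G j *_) (e-off (i≢j ∘ sym)) ⟨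
    deg G j * e j i  ∎
    where open ≡-Reasoning

⊡-lapℚ : ∀ {n} (G : Graph n) x i → (lapℚ G ⊡ x) i ≡ deg G i * x i + - 1ℚ * (adjℚ G ⊡ x) i
⊡-lapℚ G x i = begin
  lapℚ G i · x
    ≡⟨ ·-comm (lapℚ G i) x ⟩
  x · lapℚ G i
    ≡⟨ ·-congʳ x (lapℚ≡ G i) ⟩
  x · (λ j → deg G i * e i j + - 1ℚ * adjℚ G i j)
    ≡⟨ ·-linearʳ x (e i) (adjℚ G i) (deg G i) (- 1ℚ) ⟩
  deg G i * x · e i + - 1ℚ * x · adjℚ G i
    ≡⟨ cong₂ (λ p q → deg G i * p + - 1ℚ * q) (·-e x i) (·-comm x (adjℚ G i)) ⟩
  deg G i * x i + - 1ℚ * adjℚ G i · x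
    ∎
  where open ≡-Reasoning

energy : ∀ {n} → Graph n → Vector ℚ n → Matrix ℚ n
energy G x i j = adjℚ G i j * ((x i - x j) * (x i - x j))

energy-sym : ∀ {n} (G : Graph n) x → Symmetric (energy G x)
energy-sym G x i j = cong₂ _*_ (adjℚ-sym G i j)
  (solve 2 (λ a b → (a :- b) :* (a :- b) := (b :- a) :* (b :- a)) refl (x i) (x j))

0≤energy : ∀ {n} (G : Graph n) x i j → 0ℚ ≤ energy G x i j
0≤energy G x i j = 0≤* (0≤𝟙 (adj G i j)) (0≤² (x i - x j))

-- The double sum meets every edge in both orientations, hence the factor 2. Each term splits into
-- two parts that swapping i and j exchanges, and each part sums to the form.
dirichlet : ∀ {n} (G : Graph n) x →
            ∑ (λ i → ∑ (energy G x i)) ≡ Q (lapℚ G) x + Q (lapℚ G) x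
dirichlet {n} G x = begin
  ∑ (λ i → ∑ (λ j → energy G x i j))
    ≡⟨ sum-cong-≗ (λ i → sum-cong-≗ (λ j → solve 3 (λ a s t →
         a :* ((s :- t) :* (s :- t)) := a :* (s :* (s :- t)) :+ a :* (t :* (t :- s)))
         refl (adjℚ G i j) (x i) (x j))) ⟩
  ∑ (λ i → ∑ (λ j → f i j + f′ i j))
    ≡⟨ sum-cong-≗ (λ i → ∑-distrib-+ (f i) (f′ i)) ⟩
  ∑ (λ i → ∑ (f i) + ∑ (f′ i))
    ≡⟨ ∑-distrib-+ (λ i → ∑ (f i)) (λ i → ∑ (f′ i)) ⟩
  ∑ (λ i → ∑ (f i)) + ∑ (λ i → ∑ (f′ i))
    ≡⟨ cong₂ _+_ (sum-cong-≗ row≡) (trans (∑-comm f′) (sum-cong-≗ λ j →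
         trans (sum-cong-≗ λ i → cong (_* (x j * (x j - x i))) (adjℚ-sym G i j)) (row≡ j))) ⟩
  Q (lapℚ G) x + Q (lapℚ G) x
    ∎
  where
  open ≡-Reasoning
  f f′ : Matrix ℚ n
  f  i j = adjℚ G i j * (x i * (x i - x j))
  f′ i j = adjℚ G i j * (x j * (x j - x i))
  row≡ : ∀ i → ∑ (f i) ≡ x i * (lapℚ G ⊡ x) i
  row≡ i = begin
    ∑ (λ j → adjℚ G i j * (x i * (x i - x j)))
      ≡⟨ sum-cong-≗ (λ j → solve 3 (λ a s t → a :* (s :* (s :- t)) := s :* s :* a :+ (:- s) :* (a :* t))
           refl (adjℚ G i j) (x i) (x j)) ⟩
    ∑ (λ j → x i * x i * adjℚ G i j + - x i * (adjℚ G i j * x j))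
      ≡⟨ ∑-distrib-+ (λ j → x i * x i * adjℚ G i j) (λ j → - x i * (adjℚ G i j * x j)) ⟩
    ∑ (λ j → x i * x i * adjℚ G i j) + ∑ (λ j → - x i * (adjℚ G i j * x j))
      ≡⟨ cong₂ _+_ (*-distribˡ-sum (x i * x i) (adjℚ G i)) (*-distribˡ-sum (- x i) (λ j → adjℚ G i j * x j)) ⟨
    x i * x i * deg G i + - x i * (adjℚ G ⊡ x) i
      ≡⟨ solve 3 (λ s d a → s :* s :* d :+ (:- s) :* a := s :* (d :* s :+ con (- 1ℚ) :* a)) refl
           (x i) (deg G i) ((adjℚ G ⊡ x) i) ⟩
    x i * (deg G i * x i + - 1ℚ * (adjℚ G ⊡ x) i)
      ≡⟨ cong (x i *_) (⊡-lapℚ G x i) ⟨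
    x i * (lapℚ G ⊡ x) i
      ∎

size : ℕ → ℚ
size n = ∑ {n} λ _ → 1ℚ

size≡ι : ∀ n → size n ≡ ι n
size≡ι zero    = refl
size≡ι (suc n) = trans (cong (1ℚ +_) (size≡ι n)) (sym (ι-suc n))

sum-const : ∀ n c → ∑ {n} (λ _ → c) ≡ ι n * c
sum-const n c = begin
  ∑ {n} (λ _ → c)       ≡⟨ sum-cong-≗ {n} (λ _ → sym (ℚ.*-identityʳ c)) ⟩
  ∑ {n} (λ _ → c * 1ℚ)  ≡⟨ *-distribˡ-sum {n} c (λ _ → 1ℚ) ⟨
  c * size n              ≡⟨ cong (c *_) (size≡ι n) ⟩
  c * ι n                 ≡⟨ ℚ.*-comm c (ι n) ⟩
  ι n * c                 ∎
  where open ≡-Reasoning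

-- From (s - t)² ≤ 2 s² + 2 t², extended to all pairs of vertices. The crude constant serves as the
-- starting point of the search for the top eigenvalue.
lapℚ≼ : ∀ {n} (G : Graph n) → lapℚ G ≼ (ι n + ι n)
lapℚ≼ {n} G x = ℚ.*-cancelˡ-≤-pos (1ℚ + 1ℚ) (begin
  (1ℚ + 1ℚ) * Q (lapℚ G) x
    ≡⟨ solve 1 (λ q → (con 1ℚ :+ con 1ℚ) :* q := q :+ q) refl (Q (lapℚ G) x) ⟩
  Q (lapℚ G) x + Q (lapℚ G) x
    ≡⟨ dirichlet G x ⟨
  ∑ (λ i → ∑ (energy G x i))
    ≤⟨ sum-mono (λ i → sum-mono (bound i)) ⟩
  ∑ (λ i → ∑ (λ j → s i + s j))
    ≡⟨ sum-cong-≗ (λ i → trans (∑-distrib-+ (λ _ → s i) s) (cong (_+ ∑ s) (sum-const n (s i)))) ⟩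
  ∑ (λ i → ι n * s i + ∑ s)
    ≡⟨ ∑-distrib-+ (λ i → ι n * s i) (λ _ → ∑ s) ⟩
  ∑ (λ i → ι n * s i) + ∑ {n} (λ _ → ∑ s)
    ≡⟨ cong₂ _+_ (sym (*-distribˡ-sum (ι n) s)) (sum-const n (∑ s)) ⟩
  ι n * ∑ s + ι n * ∑ s
    ≡⟨ cong (λ t → ι n * t + ι n * t) (*-distribˡ-sum (1ℚ + 1ℚ) (λ i → x i * x i)) ⟨
  ι n * ((1ℚ + 1ℚ) * x · x) + ι n * ((1ℚ + 1ℚ) * x · x)
    ≡⟨ solve 2 (λ n s → let t = con 1ℚ :+ con 1ℚ in
         n :* (t :* s) :+ n :* (t :* s) := t :* ((n :+ n) :* s)) refl (ι n) (x · x) ⟩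
  (1ℚ + 1ℚ) * ((ι n + ι n) * x · x)
    ∎)
  where
  open ℚ.≤-Reasoning
  s : Vector ℚ n
  s i = (1ℚ + 1ℚ) * (x i * x i)
  bound : ∀ i j → energy G x i j ≤ s i + s j
  bound i j with adj G i j
  ... | true  = ≤-by ((x i + x j) * (x i + x j)) (0≤² (x i + x j))
    (solve 2 (λ a b → let t = con 1ℚ :+ con 1ℚ in
      con 1ℚ :* ((a :- b) :* (a :- b)) :+ (a :+ b) :* (a :+ b) := t :* (a :* a) :+ t :* (b :* b)) refl (x i) (x j))
  ... | false = ≤-by (s i + s j) (0≤+ (0≤* 0≤2 (0≤² (x i))) (0≤* 0≤2 (0≤² (x j))))
    (solve 3 (λ d a b → con 0ℚ :* d :+ (a :+ b) := a :+ b) refl ((x i - x j) * (x i - x j)) (s i) (s j))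
    where
    0≤2 : 0ℚ ≤ 1ℚ + 1ℚ
    0≤2 = ℚ.<⇒≤ (ℚ.positive⁻¹ (1ℚ + 1ℚ))

-- The test vector deg(v) at v, -1 at each neighbour of v.
module Star {n} (G : Graph n) (v : Fin n) where

  private
    d = deg G v

  star : Vector ℚ n
  star i = d * e v i - adjℚ G v i

  star-centre : star v ≡ d
  star-centre = trans (cong₂ (λ p q → d * p - q) (e-diag v) (adjℚ-diag G v))
    (solve 1 (λ d → d :* con 1ℚ :- con 0ℚ := d) refl d)

  private
    0or1 : ∀ i → adjℚ G v i ≡ 0ℚ ⊎ (adjℚ G v i ≡ 1ℚ × e v i ≡ 0ℚ)
    0or1 i with v ≟ᶠ i
    ... | yes refl = inj₁ (adjℚ-diag G v)
    ... | no  v≢i with adj G v i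
    ...   | true  = inj₂ (refl , e-off v≢i)
    ...   | false = inj₁ refl

    e² : ∀ i → e v i * e v i ≡ e v i
    e² i with v ≟ᶠ i
    ... | yes refl = trans (cong (_* e v v) (e-diag v)) (ℚ.*-identityˡ (e v v))
    ... | no  v≢i  = trans (cong (_* e v i) (e-off v≢i)) (trans (ℚ.*-zeroˡ (e v i)) (sym (e-off v≢i)))

    sum-e : ∀ c → ∑ (λ i → c * e v i) ≡ c
    sum-e c = ·-e (λ _ → c) v

  star·star : star · star ≡ d * d + d
  star·star = begin
    ∑ (λ i → star i * star i)                     ≡⟨ sum-cong-≗ entry ⟩
    ∑ (λ i → d * d * e v i + adjℚ G v i)          ≡⟨ ∑-distrib-+ (λ i → d * d * e v i) (adjℚ G v) ⟩
    ∑ (λ i → d * d * e v i) + d                   ≡⟨ cong (_+ d) (sum-e (d * d)) ⟩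
    d * d + d                                       ∎
    where
    open ≡-Reasoning
    entry : ∀ i → star i * star i ≡ d * d * e v i + adjℚ G v i
    entry i with 0or1 i
    ... | inj₁ a≡0 = begin
      star i * star i                     ≡⟨ cong (λ a → (d * e v i - a) * (d * e v i - a)) a≡0 ⟩
      (d * e v i - 0ℚ) * (d * e v i - 0ℚ) ≡⟨ solve 2 (λ d e → (d :* e :- con 0ℚ) :* (d :* e :- con 0ℚ)
                                               := d :* d :* (e :* e) :+ con 0ℚ) refl d (e v i) ⟩
      d * d * (e v i * e v i) + 0ℚ        ≡⟨ cong₂ (λ p q → d * d * p + q) (e² i) (sym a≡0) ⟩
      d * d * e v i + adjℚ G v i          ∎
    ... | inj₂ (a≡1 , e≡0) = begin
      star i * star i                     ≡⟨ cong₂ (λ e a → (d * e - a) * (d * e - a)) e≡0 a≡1 ⟩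
      (d * 0ℚ - 1ℚ) * (d * 0ℚ - 1ℚ)       ≡⟨ solve 1 (λ d → (d :* con 0ℚ :- con 1ℚ) :* (d :* con 0ℚ :- con 1ℚ)
                                               := d :* d :* con 0ℚ :+ con 1ℚ) refl d ⟩
      d * d * 0ℚ + 1ℚ                     ≡⟨ cong₂ (λ e a → d * d * e + a) e≡0 a≡1 ⟨
      d * d * e v i + adjℚ G v i          ∎

  private
    F = energy G star

    F-centre : ∀ j → F v j ≡ (d + 1ℚ) * (d + 1ℚ) * adjℚ G v j
    F-centre j with 0or1 j
    ... | inj₁ a≡0 = begin
      F v j                               ≡⟨ cong (_* ((star v - star j) * (star v - star j))) a≡0 ⟩
      0ℚ * ((star v - star j) * (star v - star j))  ≡⟨ ℚ.*-zeroˡ ((star v - star j) * (star v - star j)) ⟩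
      0ℚ                                  ≡⟨ ℚ.*-zeroʳ ((d + 1ℚ) * (d + 1ℚ)) ⟨
      (d + 1ℚ) * (d + 1ℚ) * 0ℚ            ≡⟨ cong ((d + 1ℚ) * (d + 1ℚ) *_) a≡0 ⟨
      (d + 1ℚ) * (d + 1ℚ) * adjℚ G v j    ∎
      where open ≡-Reasoning
    ... | inj₂ (a≡1 , e≡0) = begin
      adjℚ G v j * ((star v - star j) * (star v - star j))
        ≡⟨ cong₂ (λ y z → adjℚ G v j * ((y - z) * (y - z))) star-centre
             (cong₂ (λ e a → d * e - a) e≡0 a≡1) ⟩
      adjℚ G v j * ((d - (d * 0ℚ - 1ℚ)) * (d - (d * 0ℚ - 1ℚ)))
        ≡⟨ solve 2 (λ a d → let y = d :- (d :* con 0ℚ :- con 1ℚ) in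
             a :* (y :* y) := (d :+ con 1ℚ) :* (d :+ con 1ℚ) :* a) refl (adjℚ G v j) d ⟩
      (d + 1ℚ) * (d + 1ℚ) * adjℚ G v j
        ∎
      where open ≡-Reasoning

    R = ∑ (F v)

    R≡ : R ≡ (d + 1ℚ) * (d + 1ℚ) * d
    R≡ = trans (sum-cong-≗ F-centre) (sym (*-distribˡ-sum ((d + 1ℚ) * (d + 1ℚ)) (adjℚ G v)))

    -- Summed over i, this bounds the double sum below by its row and column at v.
    row-bound : ∀ i → F i v + R * e v i ≤ ∑ (F i)
    row-bound i with v ≟ᶠ i
    ... | yes refl = ℚ.≤-reflexive (begin
      F v v + R * e v v   ≡⟨ cong₂ (λ p q → p * ((star v - star v) * (star v - star v)) + R * q)
                               (adjℚ-diag G v) (e-diag v) ⟩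
      0ℚ * ((star v - star v) * (star v - star v)) + R * 1ℚ
                          ≡⟨ solve 2 (λ y r → con 0ℚ :* y :+ r :* con 1ℚ := r) refl
                               ((star v - star v) * (star v - star v)) R ⟩
      R                   ∎)
      where open ≡-Reasoning
    ... | no  v≢i  = begin
      F i v + R * e v i   ≡⟨ cong (λ q → F i v + R * q) (e-off v≢i) ⟩
      F i v + R * 0ℚ      ≡⟨ solve 2 (λ f r → f :+ r :* con 0ℚ := f) refl (F i v) R ⟩
      F i v               ≤⟨ entry≤∑ (F i) (0≤energy G star i) v ⟩
      ∑ (F i)           ∎
      where open ℚ.≤-Reasoning

  -- Only the edges at v are kept: each joins the entries d and -1, so it contributes (d + 1)², and
  -- there are d of them.
  star-energy : (d + 1ℚ) * (d + 1ℚ) * d ≤ Q (lapℚ G) star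
  star-energy = ℚ.*-cancelˡ-≤-pos (1ℚ + 1ℚ) (begin
    (1ℚ + 1ℚ) * ((d + 1ℚ) * (d + 1ℚ) * d)   ≡⟨ cong ((1ℚ + 1ℚ) *_) R≡ ⟨
    (1ℚ + 1ℚ) * R                           ≡⟨ solve 1 (λ r → (con 1ℚ :+ con 1ℚ) :* r := r :+ r) refl R ⟩
    R + R                                   ≡⟨ cong₂ _+_ (sum-cong-≗ λ i → energy-sym G star v i) (sym (sum-e R)) ⟩
    ∑ (λ i → F i v) + ∑ (λ i → R * e v i)  ≡⟨ ∑-distrib-+ (λ i → F i v) (λ i → R * e v i) ⟨
    ∑ (λ i → F i v + R * e v i)           ≤⟨ sum-mono row-bound ⟩
    ∑ (λ i → ∑ (F i))                   ≡⟨ dirichlet G star ⟩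
    Q (lapℚ G) star + Q (lapℚ G) star       ≡⟨ solve 1 (λ q → (con 1ℚ :+ con 1ℚ) :* q := q :+ q) refl (Q (lapℚ G) star) ⟨
    (1ℚ + 1ℚ) * Q (lapℚ G) star             ∎)
    where open ℚ.≤-Reasoning

  -- The quotient of d (d + 1)² by `star · star`, which is d (d + 1); positivity of d allows the
  -- cancellation.
  deg+1≤ : ∀ t → 0ℚ < d → lapℚ G ≼ t → d + 1ℚ ≤ t
  deg+1≤ t 0<d L≼t = ℚ.*-cancelˡ-≤-pos (d * d + d) {{positive 0<d²+d}} (begin
    (d * d + d) * (d + 1ℚ)      ≡⟨ solve 1 (λ d → (d :* d :+ d) :* (d :+ con 1ℚ) := (d :+ con 1ℚ) :* (d :+ con 1ℚ) :* d) refl d ⟩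
    (d + 1ℚ) * (d + 1ℚ) * d     ≤⟨ star-energy ⟩
    Q (lapℚ G) star             ≤⟨ L≼t star ⟩
    t * star · star             ≡⟨ cong (t *_) star·star ⟩
    t * (d * d + d)             ≡⟨ ℚ.*-comm t (d * d + d) ⟩
    (d * d + d) * t             ∎)
    where
    open ℚ.≤-Reasoning
    0<d²+d : 0ℚ < d * d + d
    0<d²+d = 0<+ (0<* 0<d 0<d) (ℚ.<⇒≤ 0<d)

lapℚ⋠0 : ∀ {n} (G : Graph n) v → 0ℚ < deg G v → ¬ (lapℚ G ≼ 0ℚ)
lapℚ⋠0 G v 0<d L≼0 = ℚ.<-irrefl refl
  (ℚ.<-≤-trans (0<+ 0<d (ℚ.<⇒≤ (ℚ.positive⁻¹ 1ℚ))) (Star.deg+1≤ G v 0ℚ 0<d L≼0))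

-- The handshake lemma

sumBy : {A : Set} → (A → ℚ) → List A → ℚ
sumBy f = List.foldr (λ x s → f x + s) 0ℚ

ι-length-filterᵇ : ∀ {A : Set} (p : A → Bool) xs →
                   ι (length (filterᵇ p xs)) ≡ sumBy (𝟙 ∘ p) xs
ι-length-filterᵇ p []       = refl
ι-length-filterᵇ p (x ∷ xs) with p x
... | true  = trans (ι-suc (length (filterᵇ p xs))) (cong (1ℚ +_) (ι-length-filterᵇ p xs))
... | false = trans (ι-length-filterᵇ p xs) (sym (ℚ.+-identityˡ _))

sumBy-map-++ : ∀ {A B : Set} (f : B → ℚ) (g : A → B) xs ys →
               sumBy f (List.map g xs List.++ ys) ≡ sumBy (f ∘ g) xs + sumBy f ys
sumBy-map-++ f g []       ys = sym (ℚ.+-identityˡ (sumBy f ys))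
sumBy-map-++ f g (x ∷ xs) ys =
  trans (cong (f (g x) +_) (sumBy-map-++ f g xs ys))
        (sym (ℚ.+-assoc (f (g x)) (sumBy (f ∘ g) xs) (sumBy f ys)))

sumBy-cartesianProduct : ∀ {A B : Set} (f : A × B → ℚ) xs ys →
  sumBy f (cartesianProduct xs ys) ≡ sumBy (λ x → sumBy (λ y → f (x , y)) ys) xs
sumBy-cartesianProduct f []       ys = refl
sumBy-cartesianProduct f (x ∷ xs) ys =
  trans (sumBy-map-++ f (x ,_) ys (cartesianProduct xs ys))
        (cong (sumBy (λ y → f (x , y)) ys +_) (sumBy-cartesianProduct f xs ys))

sumBy-tabulate : ∀ {A : Set} {n} (f : A → ℚ) (g : Fin n → A) → sumBy f (List.tabulate g) ≡ ∑ (f ∘ g)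
sumBy-tabulate {n = zero}  f g = refl
sumBy-tabulate {n = suc n} f g = cong (f (g zero) +_) (sumBy-tabulate f (g ∘ suc))

-- The edge list records a pair only when i < j. Adding the transposed count restores the adjacency
-- matrix, whose total is the degree sum.
handshake : ∀ {n} (G : Graph n) → ι (numEdges G) + ι (numEdges G) ≡ ∑ (deg G)
handshake {n} G = begin
  ι (numEdges G) + ι (numEdges G)
    ≡⟨ cong₂ _+_ numEdges≡ numEdges≡ ⟩
  ∑ (λ i → ∑ (u i)) + ∑ (λ i → ∑ (u i))
    ≡⟨ cong (∑ (λ i → ∑ (u i)) +_) (∑-comm u) ⟩
  ∑ (λ i → ∑ (u i)) + ∑ (λ i → ∑ (λ j → u j i))
    ≡⟨ ∑-distrib-+ (λ i → ∑ (u i)) (λ i → ∑ (λ j → u j i)) ⟨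
  ∑ (λ i → ∑ (u i) + ∑ (λ j → u j i))
    ≡⟨ sum-cong-≗ (λ i → ∑-distrib-+ (u i) (λ j → u j i)) ⟨
  ∑ (λ i → ∑ (λ j → u i j + u j i))
    ≡⟨ sum-cong-≗ (λ i → sum-cong-≗ (λ j → oriented i j)) ⟩
  ∑ (deg G)
    ∎
  where
  open ≡-Reasoning
  edge : Fin n × Fin n → Bool
  edge (i , j) = isYes (i Fin.<? j) ∧ adj G i j
  u : Matrix ℚ n
  u i j = 𝟙 (edge (i , j))
  numEdges≡ : ι (numEdges G) ≡ ∑ (λ i → ∑ (u i))
  numEdges≡ = begin
    ι (numEdges G)
      ≡⟨ ι-length-filterᵇ edge (cartesianProduct (allFin n) (allFin n)) ⟩
    sumBy (𝟙 ∘ edge) (cartesianProduct (allFin n) (allFin n))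
      ≡⟨ sumBy-cartesianProduct (𝟙 ∘ edge) (allFin n) (allFin n) ⟩
    sumBy (λ i → sumBy (u i) (allFin n)) (allFin n)
      ≡⟨ sumBy-tabulate (λ i → sumBy (u i) (allFin n)) (λ i → i) ⟩
    ∑ (λ i → sumBy (u i) (allFin n))
      ≡⟨ sum-cong-≗ (λ i → sumBy-tabulate (u i) (λ j → j)) ⟩
    ∑ (λ i → ∑ (u i))
      ∎
  oriented : ∀ i j → u i j + u j i ≡ adjℚ G i j
  oriented i j with i Fin.<? j | j Fin.<? i
  ... | yes i<j | yes j<i = contradiction j<i (Fin.<-asym i<j)
  ... | yes i<j | no  _   = ℚ.+-identityʳ (adjℚ G i j)
  ... | no  _   | yes _   = trans (ℚ.+-identityˡ (adjℚ G j i)) (adjℚ-sym G j i)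
  ... | no  i≮j | no  j≮i with Fin.<-cmp i j
  ...   | tri< i<j _ _    = contradiction i<j i≮j
  ...   | tri≈ _ refl _   = sym (adjℚ-diag G i)
  ...   | tri> _ _ j<i    = contradiction j<i j≮i

-- Unions of complete graphs

sum-split : ∀ m {n} (f : Vector ℚ (m ℕ.+ n)) →
            ∑ f ≡ ∑ (λ i → f (i ↑ˡ n)) + ∑ (λ j → f (m ↑ʳ j))
sum-split zero    f = sym (ℚ.+-identityˡ (∑ f))
sum-split (suc m) f = trans (cong (f zero +_) (sum-split m (f ∘ suc))) (sym (ℚ.+-assoc (f zero) _ _))

↑-elim : ∀ m {n} (P : Fin (m ℕ.+ n) → Set) →
         (∀ i → P (i ↑ˡ n)) → (∀ j → P (m ↑ʳ j)) → ∀ k → P k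
↑-elim zero    P l r k       = r k
↑-elim (suc m) P l r zero    = l zero
↑-elim (suc m) P l r (suc k) = ↑-elim m (P ∘ suc) (l ∘ suc) r k

module _ {a b} (G : Graph a) (H : Graph b) where

  private
    sum-0 : ∀ n (f : Vector ℚ n) → (∀ i → f i ≡ 0ℚ) → ∑ f ≡ 0ℚ
    sum-0 n f f≡0 = trans (sum-cong-≗ f≡0) (trans (sum-const n 0ℚ) (ℚ.*-zeroʳ (ι n)))

  adj-ˡˡ : ∀ i j → adj (G ∪ H) (i ↑ˡ b) (j ↑ˡ b) ≡ adj G i j
  adj-ˡˡ i j rewrite Fin.splitAt-↑ˡ a i b | Fin.splitAt-↑ˡ a j b = refl

  adj-ˡʳ : ∀ i j → adj (G ∪ H) (i ↑ˡ b) (a ↑ʳ j) ≡ false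
  adj-ˡʳ i j rewrite Fin.splitAt-↑ˡ a i b | Fin.splitAt-↑ʳ a b j = refl

  adj-ʳˡ : ∀ i j → adj (G ∪ H) (a ↑ʳ i) (j ↑ˡ b) ≡ false
  adj-ʳˡ i j rewrite Fin.splitAt-↑ʳ a b i | Fin.splitAt-↑ˡ a j b = refl

  adj-ʳʳ : ∀ i j → adj (G ∪ H) (a ↑ʳ i) (a ↑ʳ j) ≡ adj H i j
  adj-ʳʳ i j rewrite Fin.splitAt-↑ʳ a b i | Fin.splitAt-↑ʳ a b j = refl

  ⊡-adj-∪ˡ : ∀ x i → (adjℚ (G ∪ H) ⊡ x) (i ↑ˡ b) ≡ (adjℚ G ⊡ (λ j → x (j ↑ˡ b))) i
  ⊡-adj-∪ˡ x i = trans (sum-split a (λ k → adjℚ (G ∪ H) (i ↑ˡ b) k * x k))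
    (trans (cong₂ _+_ (sum-cong-≗ λ j → cong (λ c → 𝟙 c * x (j ↑ˡ b)) (adj-ˡˡ i j))
                      (sum-0 b _ λ j → trans (cong (λ c → 𝟙 c * x (a ↑ʳ j)) (adj-ˡʳ i j)) (ℚ.*-zeroˡ (x (a ↑ʳ j)))))
           (ℚ.+-identityʳ _))

  ⊡-adj-∪ʳ : ∀ x i → (adjℚ (G ∪ H) ⊡ x) (a ↑ʳ i) ≡ (adjℚ H ⊡ (λ j → x (a ↑ʳ j))) i
  ⊡-adj-∪ʳ x i = trans (sum-split a (λ k → adjℚ (G ∪ H) (a ↑ʳ i) k * x k))
    (trans (cong₂ _+_ (sum-0 a _ λ j → trans (cong (λ c → 𝟙 c * x (j ↑ˡ b)) (adj-ʳˡ i j)) (ℚ.*-zeroˡ (x (j ↑ˡ b))))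
                      (sum-cong-≗ λ j → cong (λ c → 𝟙 c * x (a ↑ʳ j)) (adj-ʳʳ i j)))
           (ℚ.+-identityˡ _))

  Q-adj-∪ : ∀ x → Q (adjℚ (G ∪ H)) x ≡
            Q (adjℚ G) (λ i → x (i ↑ˡ b)) + Q (adjℚ H) (λ j → x (a ↑ʳ j))
  Q-adj-∪ x = trans (sum-split a (λ k → x k * (adjℚ (G ∪ H) ⊡ x) k))
    (cong₂ _+_ (sum-cong-≗ λ i → cong (x (i ↑ˡ b) *_) (⊡-adj-∪ˡ x i))
               (sum-cong-≗ λ j → cong (x (a ↑ʳ j) *_) (⊡-adj-∪ʳ x j)))

  deg-∪ˡ : ∀ i → deg (G ∪ H) (i ↑ˡ b) ≡ deg G i
  deg-∪ˡ i = trans (sum-split a (adjℚ (G ∪ H) (i ↑ˡ b)))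
    (trans (cong₂ _+_ (sum-cong-≗ λ j → cong 𝟙 (adj-ˡˡ i j)) (sum-0 b _ λ j → cong 𝟙 (adj-ˡʳ i j)))
           (ℚ.+-identityʳ (deg G i)))

  deg-∪ʳ : ∀ i → deg (G ∪ H) (a ↑ʳ i) ≡ deg H i
  deg-∪ʳ i = trans (sum-split a (adjℚ (G ∪ H) (a ↑ʳ i)))
    (trans (cong₂ _+_ (sum-0 a _ λ j → cong 𝟙 (adj-ʳˡ i j)) (sum-cong-≗ λ j → cong 𝟙 (adj-ʳʳ i j)))
           (ℚ.+-identityˡ (deg H i)))

-- The matrix J - I, with the all-ones entry written `1ℚ * 1ℚ` to fit `·-linearʳ`.
adjℚ-K : ∀ n (i j : Fin n) → adjℚ (K n) i j ≡ 1ℚ * 1ℚ + - 1ℚ * e i j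
adjℚ-K n i j with i ≟ᶠ j
... | yes refl = cong (λ p → 1ℚ * 1ℚ + - 1ℚ * p) (sym (e-diag i))
... | no  i≢j  = cong (λ p → 1ℚ * 1ℚ + - 1ℚ * p) (sym (e-off i≢j))

⊡-adj-K : ∀ n x (i : Fin n) → (adjℚ (K n) ⊡ x) i ≡ ∑ x * 1ℚ + - 1ℚ * x i
⊡-adj-K n x i = begin
  adjℚ (K n) i · x                          ≡⟨ ·-comm (adjℚ (K n) i) x ⟩
  x · adjℚ (K n) i                          ≡⟨ ·-congʳ x (adjℚ-K n i) ⟩
  x · (λ j → 1ℚ * 1ℚ + - 1ℚ * e i j)        ≡⟨ ·-linearʳ x (λ _ → 1ℚ) (e i) 1ℚ (- 1ℚ) ⟩
  1ℚ * x · (λ _ → 1ℚ) + - 1ℚ * x · e i      ≡⟨ cong₂ (λ p q → 1ℚ * p + - 1ℚ * q)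
                                                 (sum-cong-≗ λ j → ℚ.*-identityʳ (x j)) (·-e x i) ⟩
  1ℚ * ∑ x + - 1ℚ * x i                   ≡⟨ cong (_+ - 1ℚ * x i) (ℚ.*-comm 1ℚ (∑ x)) ⟩
  ∑ x * 1ℚ + - 1ℚ * x i                   ∎
  where open ≡-Reasoning

Q-adj-K : ∀ n x → Q (adjℚ (K n)) x + x · x ≡ ∑ x * ∑ x
Q-adj-K n x = begin
  x · (adjℚ (K n) ⊡ x) + x · x
    ≡⟨ cong (_+ x · x) (trans (·-congʳ x (⊡-adj-K n x)) (·-linearʳ x (λ _ → 1ℚ) x (∑ x) (- 1ℚ))) ⟩
  ∑ x * x · (λ _ → 1ℚ) + - 1ℚ * x · x + x · x
    ≡⟨ cong (λ p → ∑ x * p + - 1ℚ * x · x + x · x) (sum-cong-≗ λ j → ℚ.*-identityʳ (x j)) ⟩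
  ∑ x * ∑ x + - 1ℚ * x · x + x · x
    ≡⟨ solve 2 (λ s q → s :* s :+ con (- 1ℚ) :* q :+ q := s :* s) refl (∑ x) (x · x) ⟩
  ∑ x * ∑ x
    ∎
  where open ≡-Reasoning

deg-K : ∀ n i → deg (K n) i + 1ℚ ≡ ι n
deg-K n i = begin
  deg (K n) i + 1ℚ
    ≡⟨ cong (_+ 1ℚ) (sum-cong-≗ λ j → ℚ.*-identityʳ (adjℚ (K n) i j)) ⟨
  (adjℚ (K n) ⊡ (λ _ → 1ℚ)) i + 1ℚ
    ≡⟨ cong (_+ 1ℚ) (⊡-adj-K n (λ _ → 1ℚ) i) ⟩
  size n * 1ℚ + - 1ℚ * 1ℚ + 1ℚ
    ≡⟨ solve 1 (λ s → s :* con 1ℚ :+ con (- 1ℚ) :* con 1ℚ :+ con 1ℚ := s) refl (size n) ⟩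
  size n
    ≡⟨ size≡ι n ⟩
  ι n
    ∎
  where open ≡-Reasoning

deg-⋃K : ∀ {m ns} → All (ℕ._≤ m) ns → ∀ i → deg (⋃K ns) i + 1ℚ ≤ ι m
deg-⋃K {m} {n ∷ ns} (n≤m ∷ ns≤m) = ↑-elim n (λ k → deg (⋃K (n ∷ ns)) k + 1ℚ ≤ ι m)
  (λ i → subst (_≤ ι m) (sym (trans (cong (_+ 1ℚ) (deg-∪ˡ (K n) (⋃K ns) i)) (deg-K n i))) (ι-mono-≤ n≤m))
  (λ j → subst (λ d → d + 1ℚ ≤ ι m) (sym (deg-∪ʳ (K n) (⋃K ns) j)) (deg-⋃K ns≤m j))

sum-deg-⋃K : ∀ ns → ∑ (deg (⋃K ns)) + ι (sum ns) ≡ ι (sum (List.map (_^ 2) ns))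
sum-deg-⋃K []       = refl
sum-deg-⋃K (n ∷ ns) = begin
  ∑ (deg (⋃K (n ∷ ns))) + ι (n ℕ.+ sum ns)
    ≡⟨ cong₂ _+_ (sum-split n (deg (⋃K (n ∷ ns)))) (ι-+ n (sum ns)) ⟩
  ∑ (λ i → deg (⋃K (n ∷ ns)) (i ↑ˡ sum ns)) + ∑ (λ j → deg (⋃K (n ∷ ns)) (n ↑ʳ j)) + (ι n + ι (sum ns))
    ≡⟨ cong₂ (λ p q → p + q + (ι n + ι (sum ns)))
         (sum-cong-≗ (deg-∪ˡ (K n) (⋃K ns))) (sum-cong-≗ (deg-∪ʳ (K n) (⋃K ns))) ⟩
  ∑ (deg (K n)) + ∑ (deg (⋃K ns)) + (ι n + ι (sum ns))
    ≡⟨ solve 4 (λ a b c d → a :+ b :+ (c :+ d) := (a :+ c) :+ (b :+ d)) refl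
         (∑ (deg (K n))) (∑ (deg (⋃K ns))) (ι n) (ι (sum ns)) ⟩
  (∑ (deg (K n)) + ι n) + (∑ (deg (⋃K ns)) + ι (sum ns))
    ≡⟨ cong₂ _+_ block (sum-deg-⋃K ns) ⟩
  ι (n ^ 2) + ι (sum (List.map (_^ 2) ns))
    ≡⟨ ι-+ (n ^ 2) (sum (List.map (_^ 2) ns)) ⟨
  ι (n ^ 2 ℕ.+ sum (List.map (_^ 2) ns))
    ∎
  where
  open ≡-Reasoning
  block : ∑ (deg (K n)) + ι n ≡ ι (n ^ 2)
  block = begin
    ∑ (deg (K n)) + ι n            ≡⟨ cong (∑ (deg (K n)) +_) (size≡ι n) ⟨
    ∑ (deg (K n)) + size n         ≡⟨ ∑-distrib-+ (deg (K n)) (λ _ → 1ℚ) ⟨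
    ∑ (λ i → deg (K n) i + 1ℚ)     ≡⟨ sum-cong-≗ (deg-K n) ⟩
    ∑ {n} (λ _ → ι n)              ≡⟨ sum-const n (ι n) ⟩
    ι n * ι n                        ≡⟨ ι-* n n ⟨
    ι (n ℕ.* n)                      ≡⟨ cong (λ k → ι (n ℕ.* k)) (ℕ.*-identityʳ n) ⟨
    ι (n ^ 2)                        ∎

-- A + I is a direct sum of all-ones blocks.
0≤Q-adj-⋃K : ∀ ns x → 0ℚ ≤ Q (adjℚ (⋃K ns)) x + x · x
0≤Q-adj-⋃K []       x = ℚ.≤-refl
0≤Q-adj-⋃K (n ∷ ns) x = subst (0ℚ ≤_) (sym eq) (0≤+ (0≤² (∑ xˡ)) (0≤Q-adj-⋃K ns xʳ))
  where
  open ≡-Reasoning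
  xˡ = λ i → x (i ↑ˡ sum ns)
  xʳ = λ j → x (n ↑ʳ j)
  eq : Q (adjℚ (⋃K (n ∷ ns))) x + x · x ≡ ∑ xˡ * ∑ xˡ + (Q (adjℚ (⋃K ns)) xʳ + xʳ · xʳ)
  eq = begin
    Q (adjℚ (⋃K (n ∷ ns))) x + x · x
      ≡⟨ cong₂ _+_ (Q-adj-∪ (K n) (⋃K ns) x) (sum-split n (λ k → x k * x k)) ⟩
    Q (adjℚ (K n)) xˡ + Q (adjℚ (⋃K ns)) xʳ + (xˡ · xˡ + xʳ · xʳ)
      ≡⟨ solve 4 (λ a b c d → a :+ b :+ (c :+ d) := (a :+ c) :+ (b :+ d)) refl
           (Q (adjℚ (K n)) xˡ) (Q (adjℚ (⋃K ns)) xʳ) (xˡ · xˡ) (xʳ · xʳ) ⟩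
    (Q (adjℚ (K n)) xˡ + xˡ · xˡ) + (Q (adjℚ (⋃K ns)) xʳ + xʳ · xʳ)
      ≡⟨ cong (_+ (Q (adjℚ (⋃K ns)) xʳ + xʳ · xʳ)) (Q-adj-K n xˡ) ⟩
    ∑ xˡ * ∑ xˡ + (Q (adjℚ (⋃K ns)) xʳ + xʳ · xʳ)
      ∎

-- Since L = D - A, m I - L = (m I - D - I) + (A + I): a diagonal matrix, nonnegative because
-- degrees are at most m - 1, plus a semidefinite one.
lapℚ-⋃K≼ : ∀ {m ns} → All (ℕ._≤ m) ns → lapℚ (⋃K ns) ≼ ι m
lapℚ-⋃K≼ {m} {ns} ns≤m x = ≤-by
  (∑ (λ i → (ι m - (deg G i + 1ℚ)) * (x i * x i)) + (Q (adjℚ G) x + x · x))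
  (0≤+ (sum-nonneg λ i → 0≤* (p≤q⇒0≤q-p (deg-⋃K ns≤m i)) (0≤² (x i))) (0≤Q-adj-⋃K ns x))
  (begin
    Q (lapℚ G) x + (∑ (λ i → (ι m - (deg G i + 1ℚ)) * (x i * x i)) + (Q (adjℚ G) x + x · x))
      ≡⟨ cong₂ (λ p q → p + (q + (Q (adjℚ G) x + x · x))) Q-lap weights ⟩
    1ℚ * D + - 1ℚ * Q (adjℚ G) x + (1ℚ * ((ι m - 1ℚ) * x · x) + - 1ℚ * D + (Q (adjℚ G) x + x · x))
      ≡⟨ solve 4 (λ d a m s →
           con 1ℚ :* d :+ con (- 1ℚ) :* a :+ (con 1ℚ :* ((m :- con 1ℚ) :* s) :+ con (- 1ℚ) :* d :+ (a :+ s))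
             := m :* s) refl D (Q (adjℚ G) x) (ι m) (x · x) ⟩
    ι m * x · x
      ∎)
  where
  open ≡-Reasoning
  G = ⋃K ns
  D = x · (λ i → deg G i * x i)
  Q-lap : Q (lapℚ G) x ≡ 1ℚ * D + - 1ℚ * Q (adjℚ G) x
  Q-lap = trans (·-congʳ x λ i → trans (⊡-lapℚ G x i)
                  (cong (_+ - 1ℚ * (adjℚ G ⊡ x) i) (sym (ℚ.*-identityˡ (deg G i * x i)))))
                (·-linearʳ x (λ i → deg G i * x i) (adjℚ G ⊡ x) 1ℚ (- 1ℚ))
  weights : ∑ (λ i → (ι m - (deg G i + 1ℚ)) * (x i * x i)) ≡ 1ℚ * ((ι m - 1ℚ) * x · x) + - 1ℚ * D
  weights = begin
    ∑ (λ i → (ι m - (deg G i + 1ℚ)) * (x i * x i))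
      ≡⟨ sum-cong-≗ (λ i → solve 3 (λ m d s →
           (m :- (d :+ con 1ℚ)) :* (s :* s) := s :* (con 1ℚ :* ((m :- con 1ℚ) :* s) :+ con (- 1ℚ) :* (d :* s)))
           refl (ι m) (deg G i) (x i)) ⟩
    x · (λ i → 1ℚ * ((ι m - 1ℚ) * x i) + - 1ℚ * (deg G i * x i))
      ≡⟨ ·-linearʳ x (λ i → (ι m - 1ℚ) * x i) (λ i → deg G i * x i) 1ℚ (- 1ℚ) ⟩
    1ℚ * x · (λ i → (ι m - 1ℚ) * x i) + - 1ℚ * D
      ≡⟨ cong (λ p → 1ℚ * p + - 1ℚ * D) (·-scaleʳ x x (ι m - 1ℚ)) ⟩
    1ℚ * ((ι m - 1ℚ) * x · x) + - 1ℚ * D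
      ∎

-- Edge count of a union of complete graphs

2*C2+n≡n² : ∀ n → n C 2 ℕ.+ n C 2 ℕ.+ n ≡ n ^ 2
2*C2+n≡n² zero    = refl
2*C2+n≡n² (suc n) = begin
  suc n C 2 ℕ.+ suc n C 2 ℕ.+ suc n
    ≡⟨ cong (λ c → c ℕ.+ c ℕ.+ suc n) (trans (sym (nCk+nC[k+1]≡[n+1]C[k+1] n 1)) (cong (ℕ._+ n C 2) (nC1≡n n))) ⟩
  (n ℕ.+ n C 2) ℕ.+ (n ℕ.+ n C 2) ℕ.+ suc n
    ≡⟨ regroup n (n C 2) ⟩
  (n C 2 ℕ.+ n C 2 ℕ.+ n) ℕ.+ (n ℕ.+ n ℕ.+ 1)
    ≡⟨ cong (ℕ._+ (n ℕ.+ n ℕ.+ 1)) (2*C2+n≡n² n) ⟩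
  n ^ 2 ℕ.+ (n ℕ.+ n ℕ.+ 1)
    ≡⟨ square n ⟩
  suc n ^ 2
    ∎
  where
  open ≡-Reasoning
  regroup : ∀ n c → (n ℕ.+ c) ℕ.+ (n ℕ.+ c) ℕ.+ suc n ≡ (c ℕ.+ c ℕ.+ n) ℕ.+ (n ℕ.+ n ℕ.+ 1)
  regroup = solve-∀
  square : ∀ n → n ℕ.* (n ℕ.* 1) ℕ.+ (n ℕ.+ n ℕ.+ 1) ≡ suc n ℕ.* (suc n ℕ.* 1)
  square = solve-∀

2*sum-C2+n : ∀ ns → sum (List.map (_C 2) ns) ℕ.+ sum (List.map (_C 2) ns) ℕ.+ sum ns
                    ≡ sum (List.map (_^ 2) ns)
2*sum-C2+n []       = refl
2*sum-C2+n (n ∷ ns) = trans (regroup (n C 2) (sum (List.map (_C 2) ns)) n (sum ns))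
  (cong₂ ℕ._+_ (2*C2+n≡n² n) (2*sum-C2+n ns))
  where
  regroup : ∀ c s n t → (c ℕ.+ s) ℕ.+ (c ℕ.+ s) ℕ.+ (n ℕ.+ t) ≡ (c ℕ.+ c ℕ.+ n) ℕ.+ (s ℕ.+ s ℕ.+ t)
  regroup = solve-∀

-- Doubled and increased by the number of vertices, both sides become the sum of squares: the left
-- by the handshake lemma, the right by the binomial identity.
numEdges-⋃K : ∀ ns → numEdges (⋃K ns) ≡ sum (List.map (_C 2) ns)
numEdges-⋃K ns = double-injective (ℕ.+-cancelʳ-≡ (sum ns) (m ℕ.+ m) (c ℕ.+ c) (ι-injective (begin
  ι (m ℕ.+ m ℕ.+ sum ns)           ≡⟨ trans (ι-+ (m ℕ.+ m) (sum ns)) (cong (_+ ι (sum ns)) (ι-+ m m)) ⟩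
  ι m + ι m + ι (sum ns)           ≡⟨ cong (_+ ι (sum ns)) (handshake (⋃K ns)) ⟩
  ∑ (deg (⋃K ns)) + ι (sum ns)   ≡⟨ sum-deg-⋃K ns ⟩
  ι (sum (List.map (_^ 2) ns))     ≡⟨ cong ι (2*sum-C2+n ns) ⟨
  ι (c ℕ.+ c ℕ.+ sum ns)           ∎)))
  where
  open ≡-Reasoning
  m = numEdges (⋃K ns)
  c = sum (List.map (_C 2) ns)
  double-injective : ∀ {m c} → m ℕ.+ m ≡ c ℕ.+ c → m ≡ c
  double-injective {m} {c} eq = ℕ.*-cancelˡ-≡ m c 2
    (trans (cong (m ℕ.+_) (ℕ.+-identityʳ m)) (trans eq (sym (cong (c ℕ.+_) (ℕ.+-identityʳ c)))))

-- Comparison of largest eigenvalues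

lapℚ-edgeless : ∀ {n} (G : Graph n) → ∑ (deg G) ≤ 0ℚ → ∀ x i → (lapℚ G ⊡ x) i ≡ 0ℚ
lapℚ-edgeless G Σ≤0 x i = begin
  (lapℚ G ⊡ x) i                              ≡⟨ ⊡-lapℚ G x i ⟩
  deg G i * x i + - 1ℚ * (adjℚ G ⊡ x) i       ≡⟨ cong₂ (λ d a → d * x i + - 1ℚ * a) deg≡0
                                                   (trans (·-comm (adjℚ G i) x) (trans (·-congʳ x adj≡0) (·-0ᵛ x))) ⟩
  0ℚ * x i + - 1ℚ * 0ℚ                        ≡⟨ solve 1 (λ x → con 0ℚ :* x :+ con (- 1ℚ) :* con 0ℚ := con 0ℚ) refl (x i) ⟩
  0ℚ                                          ∎
  where
  open ≡-Reasoning
  deg≤0 : deg G i ≤ 0ℚ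
  deg≤0 = ℚ.≤-trans (entry≤∑ (deg G) (0≤deg G) i) Σ≤0
  deg≡0 : deg G i ≡ 0ℚ
  deg≡0 = ℚ.≤-antisym deg≤0 (0≤deg G i)
  adj≡0 : ∀ j → adjℚ G i j ≡ 0ℚ
  adj≡0 j = ℚ.≤-antisym (ℚ.≤-trans (entry≤∑ (adjℚ G i) (λ j → 0≤𝟙 (adj G i j)) j) deg≤0) (0≤𝟙 (adj G i j))

-- An eigenvalue equation sees a matrix only through its stagewise products with vectors. This
-- covers both a change of embedding and two Laplacians that act as zero.
eigenvalue-transfer : ∀ {n} (M M′ : Matrix ℝ n) ρ →
                      (∀ k x i → (at M k ⊡ x) i ≡ (at M′ k ⊡ x) i) →
                      IsEigenvalue M ρ → IsEigenvalue M′ ρ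
eigenvalue-transfer M M′ ρ M≡M′ (v , v≉0 , Mv≈ρv) = v , v≉0 , λ i ε 0<ε →
  eventually-map (λ {k} → subst (λ p → ∣ p - seq ρ k * seq (v i) k ∣ < ε)
    (trans (seq-*ᵥ M v i k) (trans (M≡M′ k (atᵛ v k) i) (sym (seq-*ᵥ M′ v i k)))))
    (Mv≈ρv i ε 0<ε)

-- fromℤ z and fromℚ (z / 1) agree by computation, but comparing their Cauchy
-- proofs is too expensive for the type checker; only the sequences are compared.
fromℤ⇒fromℚ : ∀ {n} (G : Graph n) ρ → IsEigenvalue (λ i j → fromℤ (laplacian G i j)) ρ → IsEigenvalue (fromℚᴹ (lapℚ G)) ρ
fromℤ⇒fromℚ G ρ = eigenvalue-transfer (λ i j → fromℤ (laplacian G i j)) (fromℚᴹ (lapℚ G)) ρ λ _ _ _ → refl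

fromℚ⇒fromℤ : ∀ {n} (G : Graph n) ρ → IsEigenvalue (fromℚᴹ (lapℚ G)) ρ → IsEigenvalue (λ i j → fromℤ (laplacian G i j)) ρ
fromℚ⇒fromℤ G ρ = eigenvalue-transfer (fromℚᴹ (lapℚ G)) (λ i j → fromℤ (laplacian G i j)) ρ λ _ _ _ → refl

-- The average of deg + 2 exceeds m. If deg + 1 < m held at every vertex, integrality would give deg
-- + 2 ≤ m everywhere, contradicting the average.
large-degree : ∀ {n} (G : Graph n) m → ι m * ι n < ∑ (deg G) + ι n + ι n →
               ∃ λ v → ι m ≤ deg G v + 1ℚ
large-degree {n} G m dense with Fin.any? (λ v → ι m ℚ.≤? deg G v + 1ℚ)
... | yes found = found
... | no  none  = contradiction (ℚ.<-≤-trans dense (begin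
  ∑ (deg G) + ι n + ι n
    ≡⟨ cong (λ s → ∑ (deg G) + s + s) (size≡ι n) ⟨
  ∑ (deg G) + size n + size n
    ≡⟨ cong (_+ size n) (∑-distrib-+ (deg G) (λ _ → 1ℚ)) ⟨
  ∑ (λ v → deg G v + 1ℚ) + size n
    ≡⟨ ∑-distrib-+ (λ v → deg G v + 1ℚ) (λ _ → 1ℚ) ⟨
  ∑ (λ v → deg G v + 1ℚ + 1ℚ)
    ≤⟨ sum-mono low ⟩
  ∑ {n} (λ _ → ι m)
    ≡⟨ trans (sum-const n (ι m)) (ℚ.*-comm (ι n) (ι m)) ⟩
  ι m * ι n
    ∎)) (ℚ.<-irrefl refl)
  where
  open ℚ.≤-Reasoning
  ι-deg+1 : ∀ v → ι (suc (degree G v)) ≡ deg G v + 1ℚ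
  ι-deg+1 v = trans (ι-suc (degree G v)) (trans (ℚ.+-comm 1ℚ (ι (degree G v))) (cong (_+ 1ℚ) (ι-degree G v)))
  low : ∀ v → deg G v + 1ℚ + 1ℚ ≤ ι m
  low v = begin
    deg G v + 1ℚ + 1ℚ            ≡⟨ cong (_+ 1ℚ) (ι-deg+1 v) ⟨
    ι (suc (degree G v)) + 1ℚ    ≡⟨ trans (ℚ.+-comm (ι (suc (degree G v))) 1ℚ) (sym (ι-suc (suc (degree G v)))) ⟩
    ι (suc (suc (degree G v)))   ≤⟨ ι-mono-≤ (ℕ.≰⇒> m≰deg+1) ⟩
    ι m                          ∎
    where
    m≰deg+1 : ¬ m ℕ.≤ suc (degree G v)
    m≰deg+1 m≤deg+1 = none (v , subst (ι m ≤_) (ι-deg+1 v) (ι-mono-≤ m≤deg+1))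

clear-denominator : ∀ m s n .{{_ : NonZero n}} → ι m - (ℤ.+ s / n) < 1ℚ → ι m * ι n < ι s + ι n
clear-denominator m s n h< = <-by (ι n * (1ℚ - (ι m - q))) (0<* (0<ι n) (p<q⇒0<q-p h<)) (begin
  ι m * ι n + ι n * (1ℚ - (ι m - q))   ≡⟨ solve 3 (λ m n q → m :* n :+ n :* (con 1ℚ :- (m :- q)) := n :* q :+ n) refl (ι m) (ι n) q ⟩
  ι n * q + ι n                        ≡⟨ cong (_+ ι n) (ι-*-/ s n) ⟩
  ι s + ι n                            ∎)
  where
  open ≡-Reasoning
  q = ℤ.+ s / n

-- The chain is m ≤ deg + 1 ≤ μ ≤ σ < ρ: every stage of μ bounds the form of L(H), and maximality of
-- σ applies once μ is an eigenvalue. The latter holds up to double negation only, which is passed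
-- on to the conclusion.
λ₁-lower-bound : ∀ {n} (H : Graph n) σ v m → 0ℚ < deg H v → ι m ≤ deg H v + 1ℚ → σ isλ₁Of H →
                 ∀ ρ → seq σ ⋘ seq ρ → ¬ ¬ ((λ _ → ι m) ⋘ seq ρ)
λ₁-lower-bound {n} H σ v m 0<d m≤d+1 (_ , σ-max) ρ σ⋘ρ ¬m⋘ρ = ¬¬eigenvalue λ eigenvalue →
  ¬m⋘ρ (⋘-trans (ι m) μ σ ρ m≤μ (σ-max μ (fromℚ⇒fromℤ H μ eigenvalue)) σ⋘ρ)
  where
  d+1≤2n : deg H v + 1ℚ ≤ ι n + ι n
  d+1≤2n = Star.deg+1≤ H v (ι n + ι n) 0<d (lapℚ≼ H)
  open TopEigenvalue (lapℚ H) (lapℚ-sym H) {ι n + ι n}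
    (ℚ.<-≤-trans (0<+ 0<d (ℚ.<⇒≤ (ℚ.positive⁻¹ 1ℚ))) d+1≤2n) (lapℚ≼ H) (lapℚ⋠0 H v 0<d)
  m≤μ : ∀ k → ι m ≤ seq μ k
  m≤μ k = ℚ.≤-trans m≤d+1 (Star.deg+1≤ H v (seq μ k) 0<d (L≼upper k))

-- Without edges the form is bounded by 0 and the grid search has no failing end, so this case goes
-- around it: both Laplacians act as zero, which makes ρ an eigenvalue of L(H) itself.
λ₁-≤-edgeless : ∀ {n} (G H : Graph n) ρ σ → ∑ (deg G) ≤ 0ℚ → ∑ (deg H) ≤ 0ℚ →
                ρ isλ₁Of G → σ isλ₁Of H → ρ ≤ʳ σ
λ₁-≤-edgeless G H ρ σ G-edgeless H-edgeless (ρ-eigenvalue , _) (_ , σ-max) =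
  σ-max ρ (eigenvalue-transfer (λ i j → fromℤ (laplacian G i j)) (λ i j → fromℤ (laplacian H i j)) ρ
    (λ _ x i → trans (lapℚ-edgeless G G-edgeless x i) (sym (lapℚ-edgeless H H-edgeless x i)))
    ρ-eigenvalue)

λ₁-≤ : ∀ {n} (G H : Graph n) ρ σ m v → lapℚ G ≼ ι m → 0ℚ < deg H v → ι m ≤ deg H v + 1ℚ →
       ρ isλ₁Of G → σ isλ₁Of H → ρ ≤ʳ σ
λ₁-≤ G H ρ σ m v L≼m 0<d m≤d+1 (ρ-eigenvalue , _) σ-λ₁ = ≤ʳ-intro ρ σ λ σ⋘ρ →
  λ₁-lower-bound H σ v m 0<d m≤d+1 σ-λ₁ ρ σ⋘ρ λ m⋘ρ →
    no-eigenvalue-above (lapℚ G) (ι m) L≼m ρ m⋘ρ (fromℤ⇒fromℚ G ρ ρ-eigenvalue)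

LEGM-criterion : ∀ {n} (G : Graph n) m → lapℚ G ≼ ι m → (m ℕ.≤ 1 → ∑ (deg G) ≤ 0ℚ) →
                 ι m * ι n < ∑ (deg G) + ι n + ι n → LEGM G
LEGM-criterion {n} G m L≼m edgeless dense H same-size ρ σ ρ-λ₁ σ-λ₁ = by-size (m ℕ.≤? 1)
  where
  same-degrees : ∑ (deg G) ≡ ∑ (deg H)
  same-degrees = begin
    ∑ (deg G)                      ≡⟨ handshake G ⟨
    ι (numEdges G) + ι (numEdges G)  ≡⟨ cong (λ m → ι m + ι m) same-size ⟨
    ι (numEdges H) + ι (numEdges H)  ≡⟨ handshake H ⟩
    ∑ (deg H)                      ∎
    where open ≡-Reasoning

  by-size : Dec (m ℕ.≤ 1) → ρ ≤ʳ σ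
  by-size (yes m≤1) = λ₁-≤-edgeless G H ρ σ
    (edgeless m≤1) (subst (_≤ 0ℚ) same-degrees (edgeless m≤1)) ρ-λ₁ σ-λ₁
  by-size (no m≰1) =
    let v , m≤d+1 = large-degree H m (subst (λ s → ι m * ι n < s + ι n + ι n) same-degrees dense)
    in λ₁-≤ G H ρ σ m v L≼m (0<deg v m≤d+1) m≤d+1 ρ-λ₁ σ-λ₁
    where
    open ℚ.≤-Reasoning
    0<deg : ∀ v → ι m ≤ deg H v + 1ℚ → 0ℚ < deg H v
    0<deg v m≤d+1 = begin-strict
      0ℚ                    <⟨ ℚ.positive⁻¹ 1ℚ ⟩
      -- Here m ≥ 2 enters: 2 ≤ m ≤ deg + 1 leaves at least one edge at v.
      ι 2 - 1ℚ              ≤⟨ ℚ.+-monoˡ-≤ (- 1ℚ) (ℚ.≤-trans (ι-mono-≤ (ℕ.≰⇒> m≰1)) m≤d+1) ⟩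
      deg H v + 1ℚ - 1ℚ     ≡⟨ solve 1 (λ d → d :+ con 1ℚ :- con 1ℚ := d) refl (deg H v) ⟩
      deg H v               ∎

⋃K-edgeless : ∀ {m} ns → All (ℕ._≤ m) ns → m ℕ.≤ 1 → ∑ (deg (⋃K ns)) ≤ 0ℚ
⋃K-edgeless ns ns≤m m≤1 = begin
  ∑ (deg (⋃K ns))              ≤⟨ sum-mono deg≤0 ⟩
  ∑ {sum ns} (λ _ → 0ℚ)       ≡⟨ trans (sum-const (sum ns) 0ℚ) (ℚ.*-zeroʳ (ι (sum ns))) ⟩
  0ℚ                             ∎
  where
  open ℚ.≤-Reasoning
  deg≤0 : ∀ i → deg (⋃K ns) i ≤ 0ℚ
  deg≤0 i = begin
    deg (⋃K ns) i               ≡⟨ solve 1 (λ d → d := d :+ con 1ℚ :- con 1ℚ) refl (deg (⋃K ns) i) ⟩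
    deg (⋃K ns) i + 1ℚ - 1ℚ     ≤⟨ ℚ.+-monoˡ-≤ (- 1ℚ) (ℚ.≤-trans (deg-⋃K ns≤m i) (ι-mono-≤ m≤1)) ⟩
    0ℚ                          ∎

-- The degree sum plus the number n of vertices is the sum of squares, so this is the hypothesis
-- multiplied by n.
⋃K-dense : ∀ m ns .{{_ : NonZero (sum ns)}} →
           ι m - (ℤ.+ sum (List.map (λ k → k ^ 2) ns) / sum ns) < 1ℚ →
           ι m * ι (sum ns) < ∑ (deg (⋃K ns)) + ι (sum ns) + ι (sum ns)
⋃K-dense m ns bound = subst (λ s → ι m * ι (sum ns) < s + ι (sum ns)) (sym (sum-deg-⋃K ns))
  (clear-denominator m (sum (List.map (_^ 2) ns)) (sum ns) bound)

open import Data.Integer using (+_)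
open import Data.List using (map)

theorem4p2 :
    ∀ (n₁ : ℕ) (ns : List ℕ) →
    let ms = n₁ ∷ ns
        n  = sum ms
        G  = ⋃K ms
    in
    (pos : All NonZero ms) →
    Linked _≥_ ms →
    (+ n₁ / 1) - (_/_ (+ sum (map (λ k → k ^ 2) ms)) n {{sum-nonZero pos}}) < 1ℚ →
    numEdges G ≡ sum (map (_C 2) ms) × LEGM G
theorem4p2 n₁ ns pos decreasing bound =
  numEdges-⋃K (n₁ ∷ ns) ,
  LEGM-criterion (⋃K (n₁ ∷ ns)) n₁ (lapℚ-⋃K≼ ms≤n₁) (⋃K-edgeless (n₁ ∷ ns) ms≤n₁)
    (⋃K-dense n₁ (n₁ ∷ ns) {{sum-nonZero pos}} bound)
  where
  ms≤n₁ : All (ℕ._≤ n₁) (n₁ ∷ ns)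
  ms≤n₁ = Linked⇒All (λ p q → ℕ.≤-trans q p) ℕ.≤-refl decreasing
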